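{- Let $n\ge2$ and let $\vec{C}_n$ be the directed cycle on $n$ vertices. Then there exists a constant $0<a<1$ such that $p_2[\vec{C}_n,q]\ge a$ for all $q$ large enough. More precisely, \begin{align*} \lim_{q\to\infty}p_0[\vec{C}_n,q]&=e^{ -1},\\ \lim_{q\to\infty}p_1[\vec{C}_n,q]&=e^{ -1},\\ \lim_{q\to\infty}p_2[\vec{C}_n,q]&=1-2e^{ -1},\\ \lim_{q\to\infty}\frac{1}{|\mathrm{F}[\vec{C}_n,q]|}\sum_{f\in\mathrm{F}[\vec{C}_n,q]}\mathrm{i}(f)&=e^{ -1}. \end{align*}
   Context: $\vec{C}_n$ has vertex set $V=\{1,\dots,n\}$ and arcs $(v-1,v)$ for $v\in V$, indices modulo $n$. For an integer $q\ge2$ let $[q]=\{0,\dots,q-1\}$. For $f=(f_1,\dots,f_n):[q]^n\to[q]^n$, the interaction graph $G(f)$ has vertex set $V$ and an arc $(u,v)$ if and only if there exist $x,y\in[q]^n$ differing only in coordinate $u$ with $f_v(x)\ne f_v(y)$. For a directed graph $D$ on $V$, $\mathrm{F}[D,q]$ is the set of all $f:[q]^n\to[q]^n$ with $G(f)=D$. Let $\mathrm{Fix}(f)$ be the set of fixed points of $f$. Then $p_0[D,q]$, $p_1[D,q]$, $p_2[D,q]$ are the proportions of $f\in\mathrm{F}[D,q]$ with $|\mathrm{Fix}(f)|=0$, $|\mathrm{Fix}(f)|=1$, $|\mathrm{Fix}(f)|\ge2$ respectively. With $d_{\mathrm H}$ the Hamming distance, $\mathrm{i}(f)=\min_{x\in[q]^n}d_{\mathrm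 H}(x,f(x))$. -}

module Defs where

open import Level using (0ℓ)
open import Data.Nat as ℕ using (ℕ; zero; suc; z≤n; s≤s; _!)
import Data.Nat.Properties as ℕ
open import Data.Nat.DivMod using (_%_)
open import Data.Integer as ℤ using (+_; -[1+_]; +≤+; +<+)
import Data.Integer.Properties as ℤ
open import Data.Rational as ℚ using (ℚ; 0ℚ; 1ℚ; ½; mkℚ)
import Data.Rational.Properties as ℚ
open import Data.Rational.Solver using (module +-*-Solver)
import Data.Rational.Unnormalised as ℚᵘ
import Data.Rational.Unnormalised.Properties as ℚᵘ
open import Algebra.Definitions.RawSemiring ℚ.+-*-rawSemiring using (_^_)
open import Data.Fin using (Fin; toℕ; combine; finToFun; funToFin)
import Data.Fin.Properties as Fin
open import Data.List as List using (List; filter; length; allFin)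
open import Data.Nat.ListAction using (sum)
open import Data.List.Extrema.Nat using (min)
open import Data.Vec using (Vec; lookup; tabulate)
import Data.Vec.Properties as Vec
open import Data.Product using (_×_; _,_; ∃; ∃-syntax; proj₁; proj₂)
open import Data.Sum using (inj₁; inj₂)
open import Function using (_∘_; _⇔_; mk⇔; Equivalence)
open import Relation.Binary using (Rel; Decidable)
open import Relation.Binary.PropositionalEquality
open import Relation.Nullary using (¬_; Dec; yes; no; ¬?; contradiction)
open import Relation.Nullary.Decidable using (map′; _×-dec_; _→-dec_)
import Relation.Unary as U

IsCauchy : (ℕ → ℚ) → Set
IsCauchy s = ∀ ε → 0ℚ ℚ.< ε →
  ∃[ N ] ∀ i j → N ℕ.≤ i → N ℕ.≤ j → ℚ.∣ s i ℚ.- s j ∣ ℚ.< ε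

-- A real is represented by a Cauchy sequence; distinct sequences may represent
-- the same real, so ℝ is only ever compared through _<_ and _≤_ below.
record ℝ : Set where
  constructor mkℝ
  field
    seq    : ℕ → ℚ
    cauchy : IsCauchy seq

open ℝ public

private
  p-p≡0 : ∀ p → ℚ.∣ p ℚ.- p ∣ ≡ 0ℚ
  p-p≡0 p = cong ℚ.∣_∣ (ℚ.+-inverseʳ p)

  half-pos : ∀ {ε} → 0ℚ ℚ.< ε → 0ℚ ℚ.< ½ ℚ.* ε
  half-pos {ε} 0<ε =
    subst (ℚ._< ½ ℚ.* ε) (ℚ.*-zeroʳ ½) (ℚ.*-monoʳ-<-pos ½ 0<ε)

  halves : ∀ ε → ½ ℚ.* ε ℚ.+ ½ ℚ.* ε ≡ ε
  halves ε = trans (sym (ℚ.*-distribʳ-+ ε ½ ½)) (ℚ.*-identityˡ ε)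

  ∣-∣-sym : ∀ p q → ℚ.∣ p ℚ.- q ∣ ≡ ℚ.∣ q ℚ.- p ∣
  ∣-∣-sym p q = trans (sym (ℚ.∣-p∣≡∣p∣ (p ℚ.- q))) (cong ℚ.∣_∣
    (solve 2 (λ a b → :- (a :- b) := b :- a) refl p q))
    where open +-*-Solver

  +-cauchy : ∀ {s t} → IsCauchy s → IsCauchy t → IsCauchy (λ k → s k ℚ.+ t k)
  +-cauchy {s} {t} cs ct ε 0<ε = M ℕ.⊔ N , λ i j hi hj → begin-strict
      ℚ.∣ (s i ℚ.+ t i) ℚ.- (s j ℚ.+ t j) ∣
        ≡⟨ cong ℚ.∣_∣ (rearrange (s i) (t i) (s j) (t j)) ⟩
      ℚ.∣ (s i ℚ.- s j) ℚ.+ (t i ℚ.- t j) ∣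
        ≤⟨ ℚ.∣p+q∣≤∣p∣+∣q∣ (s i ℚ.- s j) (t i ℚ.- t j) ⟩
      ℚ.∣ s i ℚ.- s j ∣ ℚ.+ ℚ.∣ t i ℚ.- t j ∣
        <⟨ ℚ.+-mono-<
             (proj₂ S i j (ℕ.m⊔n≤o⇒m≤o M N hi) (ℕ.m⊔n≤o⇒m≤o M N hj))
             (proj₂ T i j (ℕ.m⊔n≤o⇒n≤o M N hi) (ℕ.m⊔n≤o⇒n≤o M N hj)) ⟩
      ½ ℚ.* ε ℚ.+ ½ ℚ.* ε
        ≡⟨ halves ε ⟩
      ε ∎
    where
    open ℚ.≤-Reasoning
    S = cs (½ ℚ.* ε) (half-pos 0<ε)
    T = ct (½ ℚ.* ε) (half-pos 0<ε)
    M = proj₁ S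
    N = proj₁ T
    rearrange : ∀ a b c d →
      (a ℚ.+ b) ℚ.- (c ℚ.+ d) ≡ (a ℚ.- c) ℚ.+ (b ℚ.- d)
    rearrange = solve 4
      (λ a b c d → (a :+ b) :- (c :+ d) := (a :- c) :+ (b :- d)) refl
      where open +-*-Solver

  neg-cauchy : ∀ {s} → IsCauchy s → IsCauchy (λ k → ℚ.- s k)
  neg-cauchy {s} cs ε 0<ε = proj₁ (cs ε 0<ε) , λ i j hi hj →
    subst (ℚ._< ε)
      (trans (∣-∣-sym (s i) (s j)) (cong ℚ.∣_∣ (lemma (s i) (s j))))
      (proj₂ (cs ε 0<ε) i j hi hj)
    where
    lemma : ∀ a b → b ℚ.- a ≡ ℚ.- a ℚ.- (ℚ.- b)
    lemma = solve 2 (λ a b → b :- a := :- a :- (:- b)) refl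
      where open +-*-Solver

  ∣p∣-∣q∣≤∣p-q∣ : ∀ p q → ℚ.∣ p ∣ ℚ.- ℚ.∣ q ∣ ℚ.≤ ℚ.∣ p ℚ.- q ∣
  ∣p∣-∣q∣≤∣p-q∣ p q = begin
      ℚ.∣ p ∣ ℚ.- ℚ.∣ q ∣
        ≡⟨ cong (λ r → ℚ.∣ r ∣ ℚ.- ℚ.∣ q ∣) (lemma₁ p q) ⟩
      ℚ.∣ (p ℚ.- q) ℚ.+ q ∣ ℚ.- ℚ.∣ q ∣
        ≤⟨ ℚ.+-monoˡ-≤ (ℚ.- ℚ.∣ q ∣) (ℚ.∣p+q∣≤∣p∣+∣q∣ (p ℚ.- q) q) ⟩
      (ℚ.∣ p ℚ.- q ∣ ℚ.+ ℚ.∣ q ∣) ℚ.- ℚ.∣ q ∣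
        ≡⟨ lemma₂ ℚ.∣ p ℚ.- q ∣ ℚ.∣ q ∣ ⟩
      ℚ.∣ p ℚ.- q ∣ ∎
    where
    open ℚ.≤-Reasoning
    open +-*-Solver
    lemma₁ : ∀ a b → a ≡ (a ℚ.- b) ℚ.+ b
    lemma₁ = solve 2 (λ a b → a := (a :- b) :+ b) refl
    lemma₂ : ∀ a b → (a ℚ.+ b) ℚ.- b ≡ a
    lemma₂ = solve 2 (λ a b → (a :+ b) :- b := a) refl

  ∣∣p∣-∣q∣∣≤∣p-q∣ : ∀ p q → ℚ.∣ ℚ.∣ p ∣ ℚ.- ℚ.∣ q ∣ ∣ ℚ.≤ ℚ.∣ p ℚ.- q ∣
  ∣∣p∣-∣q∣∣≤∣p-q∣ p q with ℚ.∣p∣≡p∨∣p∣≡-p (ℚ.∣ p ∣ ℚ.- ℚ.∣ q ∣)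
  ... | inj₁ eq = ℚ.≤-trans (ℚ.≤-reflexive eq) (∣p∣-∣q∣≤∣p-q∣ p q)
  ... | inj₂ eq = ℚ.≤-trans
    (ℚ.≤-reflexive (trans eq
      (solve 2 (λ a b → :- (a :- b) := b :- a) refl ℚ.∣ p ∣ ℚ.∣ q ∣)))
    (ℚ.≤-trans (∣p∣-∣q∣≤∣p-q∣ q p) (ℚ.≤-reflexive (∣-∣-sym q p)))
    where open +-*-Solver

  abs-cauchy : ∀ {s} → IsCauchy s → IsCauchy (λ k → ℚ.∣ s k ∣)
  abs-cauchy {s} cs ε 0<ε = proj₁ (cs ε 0<ε) , λ i j hi hj →
    ℚ.≤-<-trans (∣∣p∣-∣q∣∣≤∣p-q∣ (s i) (s j)) (proj₂ (cs ε 0<ε) i j hi hj)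

infix  8 -_
infixl 7 _·_
infixl 6 _+_ _-_
infix  4 _<_ _≤_ _⟶_

fromℚ : ℚ → ℝ
fromℚ p = mkℝ (λ _ → p) λ ε 0<ε → 0 , λ _ _ _ _ →
  subst (ℚ._< ε) (sym (p-p≡0 p)) 0<ε

0ℝ 1ℝ : ℝ
0ℝ = fromℚ 0ℚ
1ℝ = fromℚ 1ℚ

_+_ : ℝ → ℝ → ℝ
x + y = mkℝ (λ k → seq x k ℚ.+ seq y k)
            (+-cauchy {seq x} {seq y} (cauchy x) (cauchy y))

-_ : ℝ → ℝ
- x = mkℝ (λ k → ℚ.- seq x k) (neg-cauchy {seq x} (cauchy x))

_-_ : ℝ → ℝ → ℝ
x - y = x + (- y)

_·_ : ℕ → ℝ → ℝ
zero  · x = 0ℝ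
suc k · x = x + k · x

∣_∣ : ℝ → ℝ
∣ x ∣ = mkℝ (λ k → ℚ.∣ seq x k ∣) (abs-cauchy {seq x} (cauchy x))

-- The gap δ makes the order independent of the representing sequences.
_<_ : ℝ → ℝ → Set
x < y = ∃[ δ ] (0ℚ ℚ.< δ) ×
  (∃[ N ] ∀ k → N ℕ.≤ k → seq x k ℚ.+ δ ℚ.≤ seq y k)

_≤_ : ℝ → ℝ → Set
x ≤ y = ¬ (y < x)

_⟶_ : (ℕ → ℝ) → ℝ → Set
x ⟶ l = ∀ ε → 0ℝ < ε → ∃[ N ] ∀ q → N ℕ.≤ q → ∣ x q - l ∣ < ε

expTerm : ℚ → ℕ → ℚ
expTerm x k = x ^ k ℚ.* ((+ 1) ℚ./ (k !)) {{k ℕ.!≢0}}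

expSum : ℚ → ℕ → ℚ
expSum x zero    = 0ℚ
expSum x (suc m) = expSum x m ℚ.+ expTerm x m

private
  frac-≤ : ∀ a b c d .{{_ : ℕ.NonZero b}} .{{_ : ℕ.NonZero d}} →
           a ℕ.* d ℕ.≤ c ℕ.* b → (+ a) ℚ./ b ℚ.≤ (+ c) ℚ./ d
  frac-≤ a (suc b) c (suc d) h = ℚ.toℚᵘ-cancel-≤ (begin
      ℚ.toℚᵘ ((+ a) ℚ./ suc b) ≃⟨ ℚ.toℚᵘ-fromℚᵘ (ℚᵘ.mkℚᵘ (+ a) b) ⟩
      ℚᵘ.mkℚᵘ (+ a) b          ≤⟨ ℚᵘ.*≤* (subst₂ ℤ._≤_
                                    (ℤ.pos-* a (suc d)) (ℤ.pos-* c (suc b))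
                                    (+≤+ h)) ⟩
      ℚᵘ.mkℚᵘ (+ c) d          ≃⟨ ℚᵘ.≃-sym (ℚ.toℚᵘ-fromℚᵘ (ℚᵘ.mkℚᵘ (+ c) d)) ⟩
      ℚ.toℚᵘ ((+ c) ℚ./ suc d) ∎)
    where open ℚᵘ.≤-Reasoning

  recip : ℕ → ℚ
  recip k = ((+ 1) ℚ./ (k !)) {{k ℕ.!≢0}}

  recip-halves : ∀ k → 1 ℕ.≤ k → recip (suc k) ℚ.≤ ½ ℚ.* recip k
  recip-halves k 1≤k = ℚ.≤-trans
    (frac-≤ 1 (suc k !) 1 (2 ℕ.* k !) {{suc k ℕ.!≢0}} {{nz}} bound)
    (ℚ.≤-reflexive (halve (k !) {{k ℕ.!≢0}}))
    where
    nz : ℕ.NonZero (2 ℕ.* k !)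
    nz = ℕ.m*n≢0 2 (k !) {{_}} {{k ℕ.!≢0}}
    bound : 1 ℕ.* (2 ℕ.* k !) ℕ.≤ 1 ℕ.* (suc k !)
    bound = ℕ.*-monoʳ-≤ 1 (ℕ.*-monoˡ-≤ (k !) (s≤s 1≤k))
    halve : ∀ m .{{_ : ℕ.NonZero m}} →
            ((+ 1) ℚ./ (2 ℕ.* m)) {{ℕ.m*n≢0 2 m}} ≡ ½ ℚ.* ((+ 1) ℚ./ m)
    halve (suc m) = ℚ.toℚᵘ-injective (ℚᵘ.≃-trans
      (ℚ.toℚᵘ-fromℚᵘ (ℚᵘ.mkℚᵘ (+ 1) (m ℕ.+ suc (m ℕ.+ 0))))
      (ℚᵘ.≃-sym (ℚᵘ.≃-trans (ℚ.toℚᵘ-homo-* ½ ((+ 1) ℚ./ suc m))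
        (ℚᵘ.*-cong (ℚᵘ.≃-refl {ℚᵘ.½}) (ℚ.toℚᵘ-fromℚᵘ (ℚᵘ.mkℚᵘ (+ 1) m))))))

  0≤recip : ∀ k → 0ℚ ℚ.≤ recip k
  0≤recip k = frac-≤ 0 1 1 (k !) {{_}} {{k ℕ.!≢0}} z≤n

  ∣-1^k∣≡1 : ∀ k → ℚ.∣ (ℚ.- 1ℚ) ^ k ∣ ≡ 1ℚ
  ∣-1^k∣≡1 zero    = refl
  ∣-1^k∣≡1 (suc k) = trans (ℚ.∣p*q∣≡∣p∣*∣q∣ (ℚ.- 1ℚ) ((ℚ.- 1ℚ) ^ k))
    (cong (1ℚ ℚ.*_) (∣-1^k∣≡1 k))

  ∣term∣ : ∀ k → ℚ.∣ expTerm (ℚ.- 1ℚ) k ∣ ≡ recip k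
  ∣term∣ k = begin
    ℚ.∣ (ℚ.- 1ℚ) ^ k ℚ.* recip k ∣         ≡⟨ ℚ.∣p*q∣≡∣p∣*∣q∣ ((ℚ.- 1ℚ) ^ k) (recip k) ⟩
    ℚ.∣ (ℚ.- 1ℚ) ^ k ∣ ℚ.* ℚ.∣ recip k ∣  ≡⟨ cong₂ ℚ._*_ (∣-1^k∣≡1 k) (ℚ.0≤p⇒∣p∣≡p (0≤recip k)) ⟩
    1ℚ ℚ.* recip k                        ≡⟨ ℚ.*-identityˡ (recip k) ⟩
    recip k                               ∎
    where open ≡-Reasoning

  s : ℕ → ℚ
  s = expSum (ℚ.- 1ℚ)

  tail : ∀ n j → 1 ℕ.≤ n →
         ℚ.∣ s (j ℕ.+ n) ℚ.- s n ∣ ℚ.+ (recip (j ℕ.+ n) ℚ.+ recip (j ℕ.+ n))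
           ℚ.≤ recip n ℚ.+ recip n
  tail n zero    1≤n = ℚ.≤-reflexive (trans
    (cong (ℚ._+ (recip n ℚ.+ recip n)) (p-p≡0 (s n))) (ℚ.+-identityˡ _))
  tail n (suc j) 1≤n = begin
      ℚ.∣ (s m ℚ.+ t) ℚ.- s n ∣ ℚ.+ (r′ ℚ.+ r′)
        ≤⟨ ℚ.+-monoʳ-≤ ℚ.∣ (s m ℚ.+ t) ℚ.- s n ∣ (ℚ.+-mono-≤ h h) ⟩
      ℚ.∣ (s m ℚ.+ t) ℚ.- s n ∣ ℚ.+ (½ ℚ.* r ℚ.+ ½ ℚ.* r)
        ≡⟨ cong₂ ℚ._+_ (cong ℚ.∣_∣ (lemma (s m) t (s n))) (halves r) ⟩
      ℚ.∣ (s m ℚ.- s n) ℚ.+ t ∣ ℚ.+ r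
        ≤⟨ ℚ.+-monoˡ-≤ r (ℚ.∣p+q∣≤∣p∣+∣q∣ (s m ℚ.- s n) t) ⟩
      (ℚ.∣ s m ℚ.- s n ∣ ℚ.+ ℚ.∣ t ∣) ℚ.+ r
        ≡⟨ cong (λ u → (ℚ.∣ s m ℚ.- s n ∣ ℚ.+ u) ℚ.+ r) (∣term∣ m) ⟩
      (ℚ.∣ s m ℚ.- s n ∣ ℚ.+ r) ℚ.+ r
        ≡⟨ ℚ.+-assoc ℚ.∣ s m ℚ.- s n ∣ r r ⟩
      ℚ.∣ s m ℚ.- s n ∣ ℚ.+ (r ℚ.+ r)
        ≤⟨ tail n j 1≤n ⟩
      recip n ℚ.+ recip n ∎
    where
    open ℚ.≤-Reasoning
    m  = j ℕ.+ n
    t  = expTerm (ℚ.- 1ℚ) m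
    r  = recip m
    r′ = recip (suc m)
    h  = recip-halves m (ℕ.≤-trans 1≤n (ℕ.m≤n+m n j))
    lemma : ∀ a b c → (a ℚ.+ b) ℚ.- c ≡ (a ℚ.- c) ℚ.+ b
    lemma = solve 3 (λ a b c → (a :+ b) :- c := (a :- c) :+ b) refl
      where open +-*-Solver

  n≤n! : ∀ n → n ℕ.≤ n !
  n≤n! zero    = z≤n
  n≤n! (suc n) = subst (ℕ._≤ suc n !) (ℕ.*-identityʳ (suc n))
    (ℕ.*-monoʳ-≤ (suc n) (ℕ.1≤n! n))

  recip-small : ∀ ε → 0ℚ ℚ.< ε →
    ∃[ N ] (1 ℕ.≤ N) × (∀ n → N ℕ.≤ n → recip n ℚ.+ recip n ℚ.< ε)
  recip-small ε 0<ε with half-pos 0<ε | halves ε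
  ... | h | eq with ½ ℚ.* ε
  ... | mkℚ -[1+ _ ] _ _ = contradiction h λ { (ℚ.*<* ()) }
  ... | mkℚ (+ zero) _ _ = contradiction h λ { (ℚ.*<* (+<+ ())) }
  ... | p@(mkℚ (+ suc a) d _) = suc (suc d) , s≤s z≤n , λ n N≤n →
    subst (recip n ℚ.+ recip n ℚ.<_) eq (ℚ.+-mono-< (bound n N≤n) (bound n N≤n))
    where
    frac-< : ∀ m .{{_ : ℕ.NonZero m}} → suc (suc d) ℕ.≤ m → (+ 1) ℚ./ m ℚ.< p
    frac-< (suc m) le = ℚ.toℚᵘ-cancel-< (ℚᵘ.<-respˡ-≃
      (ℚᵘ.≃-sym (ℚ.toℚᵘ-fromℚᵘ (ℚᵘ.mkℚᵘ (+ 1) m)))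
      (ℚᵘ.*<* (subst₂ ℤ._<_ (ℤ.pos-* 1 (suc d)) (ℤ.pos-* (suc a) (suc m))
        (+<+ (ℕ.≤-trans (ℕ.≤-trans
          (s≤s (ℕ.≤-reflexive (ℕ.*-identityˡ (suc d)))) le)
          (ℕ.m≤m+n (suc m) (a ℕ.* suc m)))))))
    bound : ∀ n → suc (suc d) ℕ.≤ n → recip n ℚ.< p
    bound n N≤n = frac-< (n !) {{n ℕ.!≢0}} (ℕ.≤-trans N≤n (n≤n! n))

  e⁻¹-cauchy : IsCauchy s
  e⁻¹-cauchy ε 0<ε with recip-small ε 0<ε
  ... | N , 1≤N , small = N , close
    where
    ordered : ∀ i j → N ℕ.≤ i → i ℕ.≤ j → ℚ.∣ s j ℚ.- s i ∣ ℚ.< ε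
    ordered i j N≤i i≤j = ℚ.≤-<-trans (begin
        ℚ.∣ s j ℚ.- s i ∣
          ≡⟨ cong (λ k → ℚ.∣ s k ℚ.- s i ∣) (sym (ℕ.m∸n+n≡m i≤j)) ⟩
        d
          ≡⟨ sym (ℚ.+-identityʳ d) ⟩
        d ℚ.+ 0ℚ
          ≤⟨ ℚ.+-monoʳ-≤ d (ℚ.+-mono-≤ (0≤recip k) (0≤recip k)) ⟩
        d ℚ.+ (recip k ℚ.+ recip k)
          ≤⟨ tail i (j ℕ.∸ i) (ℕ.≤-trans 1≤N N≤i) ⟩
        recip i ℚ.+ recip i ∎) (small i N≤i)
      where
      open ℚ.≤-Reasoning
      k = (j ℕ.∸ i) ℕ.+ i
      d = ℚ.∣ s k ℚ.- s i ∣
    close : ∀ i j → N ℕ.≤ i → N ℕ.≤ j → ℚ.∣ s i ℚ.- s j ∣ ℚ.< ε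
    close i j hi hj with ℕ.≤-total i j
    ... | inj₁ i≤j = subst (ℚ._< ε) (∣-∣-sym (s j) (s i)) (ordered i j hi i≤j)
    ... | inj₂ j≤i = ordered j i hj j≤i

-- exp (-1), as the limit of the partial sums of the exponential series.
e⁻¹ : ℝ
e⁻¹ = mkℝ (expSum (ℚ.- 1ℚ)) e⁻¹-cauchy

-- Vectors rather than functions, so that _≡_ is equality of configurations.
Config : ℕ → ℕ → Set
Config n q = Vec (Fin q) n

SelfMap : ℕ → ℕ → Set
SelfMap n q = Config n q → Config n q

encode : ∀ {n q} → Config n q → Fin (q ℕ.^ n)
encode x = funToFin (lookup x)

decode : ∀ {n q} → Fin (q ℕ.^ n) → Config n q
decode c = tabulate (finToFun c)

decode-encode : ∀ {n q} (x : Config n q) → decode (encode x) ≡ x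
decode-encode x = trans
  (Vec.tabulate-cong (Fin.finToFun-funToFin (lookup x))) (Vec.tabulate∘lookup x)

private
  funToFin-cong : ∀ {m n} {f g : Fin m → Fin n} → f ≗ g → funToFin f ≡ funToFin g
  funToFin-cong {zero}  f≗g = refl
  funToFin-cong {suc m} f≗g =
    cong₂ combine (f≗g Fin.zero) (funToFin-cong (f≗g ∘ Fin.suc))

encode-decode : ∀ n q (c : Fin (q ℕ.^ n)) → encode {n} {q} (decode c) ≡ c
encode-decode n q c = trans
  (funToFin-cong (Vec.lookup∘tabulate (finToFun {q} {n} c)))
  (Fin.funToFin-finToFin {n} {q} c)

configs : ∀ n q → List (Config n q)
configs n q = List.map decode (allFin (q ℕ.^ n))

decodeMap : ∀ {n q} → Fin ((q ℕ.^ n) ℕ.^ (q ℕ.^ n)) → SelfMap n q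
decodeMap c x = decode (finToFun c (encode x))

-- By the next two lemmas, selfMaps lists every self-map exactly once up to
-- pointwise equality.
decodeMap-surjective : ∀ {n q} (f : SelfMap n q) → ∃[ c ] decodeMap c ≗ f
decodeMap-surjective f = funToFin (encode ∘ f ∘ decode) , λ x → trans
  (cong decode (Fin.finToFun-funToFin (encode ∘ f ∘ decode) (encode x)))
  (trans (decode-encode (f (decode (encode x)))) (cong f (decode-encode x)))

decodeMap-injective : ∀ n q c d →
  decodeMap {n} {q} c ≗ decodeMap d → c ≡ d
decodeMap-injective n q c d eq = begin
  c                    ≡⟨ sym (Fin.funToFin-finToFin {m} {m} c) ⟩
  funToFin (images c)  ≡⟨ funToFin-cong pointwise ⟩
  funToFin (images d)  ≡⟨ Fin.funToFin-finToFin {m} {m} d ⟩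
  d                    ∎
  where
  m = q ℕ.^ n
  images : Fin (m ℕ.^ m) → Fin m → Fin m
  images = finToFun
  open ≡-Reasoning
  code : ∀ c k → encode (decodeMap {n} {q} c (decode k)) ≡ images c k
  code c k = trans (encode-decode n q _) (cong (images c) (encode-decode n q k))
  pointwise : images c ≗ images d
  pointwise k = trans (sym (code c k)) (trans (cong encode (eq (decode k))) (code d k))

selfMaps : ∀ n q → List (SelfMap n q)
selfMaps n q = List.map decodeMap (allFin ((q ℕ.^ n) ℕ.^ (q ℕ.^ n)))

anyConfig? : ∀ {n q} {P : Config n q → Set} → U.Decidable P → Dec (∃ P)
anyConfig? {P = P} P? = map′
  (λ (c , Pc) → decode c , Pc)
  (λ (x , Px) → encode x , subst P (sym (decode-encode x)) Px)
  (Fin.any? (P? ∘ decode))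

record Digraph (n : ℕ) : Set₁ where
  field
    Arc  : Rel (Fin n) 0ℓ
    arc? : Decidable Arc

open Digraph public

infix 4 _≗ᴳ_ _≗ᴳ?_

_≗ᴳ_ : ∀ {n} → Digraph n → Digraph n → Set
D ≗ᴳ E = ∀ u v → Arc D u v ⇔ Arc E u v

_≗ᴳ?_ : ∀ {n} (D E : Digraph n) → Dec (D ≗ᴳ E)
D ≗ᴳ? E = Fin.all? λ u → Fin.all? λ v →
  map′ (λ (f , g) → mk⇔ f g)
       (λ eq → Equivalence.to eq , Equivalence.from eq)
       ((arc? D u v →-dec arc? E u v) ×-dec (arc? E u v →-dec arc? D u v))

-- The vertices 1, …, n are renumbered 0, …, n-1.
C⃗ : ∀ n → Digraph n
C⃗ n = record
  { Arc  = λ u v → (suc (toℕ u) % n) {{Fin.nonZeroIndex u}} ≡ toℕ v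
  ; arc? = λ u v → (suc (toℕ u) % n) {{Fin.nonZeroIndex u}} ℕ.≟ toℕ v
  }

DifferOnlyAt : ∀ {n q} → Fin n → Rel (Config n q) 0ℓ
DifferOnlyAt u x y =
  lookup x u ≢ lookup y u × (∀ w → w ≢ u → lookup x w ≡ lookup y w)

differOnlyAt? : ∀ {n q} (u : Fin n) → Decidable (DifferOnlyAt {n} {q} u)
differOnlyAt? u x y =
  ¬? (lookup x u Fin.≟ lookup y u) ×-dec
  Fin.all? λ w → ¬? (w Fin.≟ u) →-dec (lookup x w Fin.≟ lookup y w)

G : ∀ {n q} → SelfMap n q → Digraph n
G {n} {q} f = record
  { Arc  = λ u v → ∃[ x ] ∃[ y ]
             DifferOnlyAt u x y × lookup (f x) v ≢ lookup (f y) v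
  ; arc? = λ u v → anyConfig? λ x → anyConfig? λ y →
             differOnlyAt? u x y ×-dec
             ¬? (lookup (f x) v Fin.≟ lookup (f y) v)
  }

F[_,_] : ∀ {n} → Digraph n → ∀ q → List (SelfMap n q)
F[_,_] {n} D q = filter (λ f → G f ≗ᴳ? D) (selfMaps n q)

Fix : ∀ {n q} → SelfMap n q → List (Config n q)
Fix {n} {q} f = filter (λ x → Vec.≡-dec Fin._≟_ (f x) x) (configs n q)

d-H : ∀ {n q} → Config n q → Config n q → ℕ
d-H {n} x y =
  length (filter (λ v → ¬? (lookup x v Fin.≟ lookup y v)) (allFin n))

-- The initial value n of min is an upper bound on d-H, so for q ≥ 1, when
-- [q]ⁿ is nonempty, this is the minimum over all configurations.
i : ∀ {n q} → SelfMap n q → ℕ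
i {n} {q} f = min n (List.map (λ x → d-H x (f x)) (configs n q))

-- The value 0 for an empty denominator is a convention; F[ C⃗ n , q ] is
-- nonempty for n ≥ 1 and q ≥ 2.
ratio : ℕ → ℕ → ℚ
ratio a zero    = 0ℚ
ratio a (suc b) = (+ a) ℚ./ suc b

proportion : ∀ {A : Set} {P : A → Set} → U.Decidable P → List A → ℚ
proportion P? xs = ratio (length (filter P? xs)) (length xs)

average : ∀ {A : Set} → (A → ℕ) → List A → ℚ
average φ xs = ratio (sum (List.map φ xs)) (length xs)

p₀ p₁ p₂ : ∀ {n} → Digraph n → ℕ → ℚ
p₀ D q = proportion (λ f → length (Fix f) ℕ.≟ 0) F[ D , q ]
p₁ D q = proportion (λ f → length (Fix f) ℕ.≟ 1) F[ D , q ]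
p₂ D q = proportion (λ f → 2 ℕ.≤? length (Fix f)) F[ D , q ]

avg-i : ∀ {n} → Digraph n → ℕ → ℚ
avg-i D q = average i F[ D , q ]

{-# OPTIONS --safe #-}
module Submission where

-- A map with interaction graph the cycle is an n-tuple of nonconstant self-maps of [q], and its fixed points
-- are those of the composition h of the tuple; walking once around the cycle from any value gives a
-- configuration with at most one wrong coordinate, so i(f) is 1 if h has no fixed point and 0 otherwise.
-- Let X be the number of fixed points of h. A k-tuple of distinct fixed points stays distinct along the
-- cycle, so E[X(X-1)⋯(X-k+1)] = (q(q-1)⋯(q-k+1) c / N)ⁿ, where N = q^q - q counts the nonconstant maps and c those
-- with k prescribed values. The moment is 1 for k ≤ 1 and 1 + O(k(k-1)/q) in general, and the indicators of
-- X = 0 and X = 1 are the alternating series ∑ (-1)ᵏ/k! (X)ₖ and ∑ (-1)ᵏ/k! (X)ₖ₊₁. Comparing their means term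
-- by term with the series of e⁻¹ shows that both probabilities are e⁻¹ + O(1/q).

-- It would not suffice that each factorial moment tends to 1: the alternating series gets longer as
-- q grows, so the errors must be summable against 1/k!, uniformly in k. This is why the moment
-- bound is stated for every k. It survives for k > q, where the moment is 0, because then q ≤ k-1;
-- and ∑ k(k+1)/k! = 3e is finite, so the total error is a constant over q. No tail of a series is
-- ever estimated. Since X ≤ q, the series for the two indicators may be cut after any index K ≥ q
-- without changing its value, and the exponential series cut at the same place is an entry of the
-- sequence representing e⁻¹. The proportions are thus compared with rational partial sums directly.
-- Moments are kept as natural numbers, with all estimates multiplied out by q and by powers of N;
-- division enters only at the end.

open import Data.Fin as Fin using (Fin)
import Data.Fin.Properties as Fin
open import Data.List as List using (List; []; _∷_; allFin; filter; length)
open import Data.List.Membership.Propositional using (_∈_)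
open import Data.List.Membership.Propositional.Properties using (∈-allFin; ∈-filter⁺; ∈-filter⁻)
import Data.List.Properties as List
open import Data.Product using (_×_; _,_; proj₁; proj₂; ∃-syntax)
open import Data.Sum using (inj₁; inj₂)
open import Data.Vec as Vec using (Vec; []; _∷_; lookup; replicate; tabulate; _[_]≔_)
import Data.Vec.Properties as Vec
open import Function using (_∘_; _⇔_; mk⇔; Equivalence)
open import Level using (0ℓ)
open import Relation.Binary.Definitions using (DecidableEquality)
open import Relation.Binary.PropositionalEquality
open import Relation.Nullary using (¬_; Dec; yes; no; ¬?; contradiction)
open import Relation.Nullary.Decidable using (_×-dec_)
open import Relation.Unary using (Pred; Decidable)

-- Finite sums and indicators over lists.

module FiniteSums where

  open import Data.List using (_++_; map; cartesianProductWith)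
  open import Data.List.Membership.Propositional.Properties using (∈-cartesianProductWith⁺; ∈-cartesianProductWith⁻)
  open import Data.List.Membership.Propositional.Properties.WithK using (unique∧set⇒bag)
  open import Data.List.Relation.Binary.BagAndSetEquality using (∼bag⇒↭)
  import Data.List.Relation.Binary.Permutation.Propositional.Properties as Perm
  open import Data.List.Relation.Unary.All as All using (All)
  open import Data.List.Relation.Unary.AllPairs using ([]; _∷_)
  open import Data.List.Relation.Unary.Any using (here; there)
  open import Data.List.Relation.Unary.Unique.Propositional using (Unique)
  import Data.List.Relation.Unary.Unique.Propositional.Properties as Unique
  open import Data.Nat
  open import Data.Nat.ListAction using (sum)
  open import Data.Nat.ListAction.Properties using (sum-↭)
  open import Data.Nat.Properties
  open import Data.Vec.Relation.Unary.All as VecAll using ([]; _∷_)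
  open import Algebra.Properties.CommutativeSemigroup +-commutativeSemigroup using (interchange)

  ∑ : {A : Set} → List A → (A → ℕ) → ℕ
  ∑ xs f = sum (map f xs)

  χ : {P : Set} → Dec P → ℕ
  χ (yes _) = 1
  χ (no _)  = 0

  χ-true : {P : Set} (P? : Dec P) → P → χ P? ≡ 1
  χ-true (yes _) p = refl
  χ-true (no ¬p) p = contradiction p ¬p

  χ-false : {P : Set} (P? : Dec P) → ¬ P → χ P? ≡ 0
  χ-false (yes p) ¬p = contradiction p ¬p
  χ-false (no _)  ¬p = refl

  χ-cong : {P Q : Set} (P? : Dec P) (Q? : Dec Q) → (P → Q) → (Q → P) → χ P? ≡ χ Q?
  χ-cong (yes p) Q? f g = sym (χ-true Q? (f p))
  χ-cong (no ¬p) Q? f g = sym (χ-false Q? (¬p ∘ g))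

  χ-× : {P Q : Set} (P? : Dec P) (Q? : Dec Q) → χ (P? ×-dec Q?) ≡ χ P? * χ Q?
  χ-× (yes _) (yes _) = refl
  χ-× (yes _) (no _)  = refl
  χ-× (no _)  (yes _) = refl
  χ-× (no _)  (no _)  = refl

  χ-≤1 : {P : Set} (P? : Dec P) → χ P? ≤ 1
  χ-≤1 (yes _) = ≤-refl
  χ-≤1 (no _)  = z≤n

  χ-restrict : {P : Set} (P? : Dec P) {m n : ℕ} → (P → m ≡ n) → χ P? * m ≡ χ P? * n
  χ-restrict (yes p) eq = cong (1 *_) (eq p)
  χ-restrict (no _)  eq = refl

  χ-absorb : {P : Set} (P? : Dec P) {m : ℕ} → (¬ P → m ≡ 0) → m ≡ χ P? * m
  χ-absorb (yes _) {m} eq = sym (*-identityˡ m)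
  χ-absorb (no ¬p) eq     = eq ¬p

  module _ {A : Set} where

    ∑-cong-∈ : (xs : List A) {f g : A → ℕ} → (∀ {x} → x ∈ xs → f x ≡ g x) → ∑ xs f ≡ ∑ xs g
    ∑-cong-∈ []       eq = refl
    ∑-cong-∈ (x ∷ xs) eq = cong₂ _+_ (eq (here refl)) (∑-cong-∈ xs (eq ∘ there))

    ∑-cong : (xs : List A) {f g : A → ℕ} → (∀ x → f x ≡ g x) → ∑ xs f ≡ ∑ xs g
    ∑-cong xs eq = ∑-cong-∈ xs (λ {x} _ → eq x)

    ∑-mono : (xs : List A) {f g : A → ℕ} → (∀ x → f x ≤ g x) → ∑ xs f ≤ ∑ xs g
    ∑-mono []       le = z≤n
    ∑-mono (x ∷ xs) le = +-mono-≤ (le x) (∑-mono xs le)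

    ∑-0 : (xs : List A) → ∑ xs (λ _ → 0) ≡ 0
    ∑-0 []       = refl
    ∑-0 (x ∷ xs) = ∑-0 xs

    ∑-1 : (xs : List A) → ∑ xs (λ _ → 1) ≡ length xs
    ∑-1 []       = refl
    ∑-1 (x ∷ xs) = cong suc (∑-1 xs)

    ∑-+ : (xs : List A) (f g : A → ℕ) → ∑ xs (λ x → f x + g x) ≡ ∑ xs f + ∑ xs g
    ∑-+ []       f g = refl
    ∑-+ (x ∷ xs) f g = trans (cong (f x + g x +_) (∑-+ xs f g)) (interchange (f x) (g x) (∑ xs f) (∑ xs g))

    ∑-*ˡ : (xs : List A) (c : ℕ) (f : A → ℕ) → ∑ xs (λ x → c * f x) ≡ c * ∑ xs f
    ∑-*ˡ []       c f = sym (*-zeroʳ c)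
    ∑-*ˡ (x ∷ xs) c f = trans (cong (c * f x +_) (∑-*ˡ xs c f)) (sym (*-distribˡ-+ c (f x) (∑ xs f)))

    ∑-*ʳ : (xs : List A) (c : ℕ) (f : A → ℕ) → ∑ xs (λ x → f x * c) ≡ ∑ xs f * c
    ∑-*ʳ xs c f = trans (∑-cong xs (λ x → *-comm (f x) c)) (trans (∑-*ˡ xs c f) (*-comm c (∑ xs f)))

    ∑-const : (xs : List A) (c : ℕ) → ∑ xs (λ _ → c) ≡ length xs * c
    ∑-const xs c = trans (∑-cong xs (λ _ → sym (*-identityˡ c))) (trans (∑-*ʳ xs c (λ _ → 1)) (cong (_* c) (∑-1 xs)))

    ∑-filter : {P : Pred A 0ℓ} (P? : Decidable P) (xs : List A) (f : A → ℕ) →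
      ∑ (filter P? xs) f ≡ ∑ xs (λ x → χ (P? x) * f x)
    ∑-filter P? []       f = refl
    ∑-filter P? (x ∷ xs) f with P? x
    ... | yes _ = cong₂ _+_ (sym (*-identityˡ (f x))) (∑-filter P? xs f)
    ... | no _  = ∑-filter P? xs f

    length-filter≡∑ : {P : Pred A 0ℓ} (P? : Decidable P) (xs : List A) →
      length (filter P? xs) ≡ ∑ xs (λ x → χ (P? x))
    length-filter≡∑ P? xs = trans (sym (∑-1 (filter P? xs)))
      (trans (∑-filter P? xs _) (∑-cong xs (λ x → *-identityʳ (χ (P? x)))))

    -- Without repetitions, equality as sets is equality as bags, so one list is a permutation of
    -- the other.
    ∑-sameElements : {xs ys : List A} → Unique xs → Unique ys →
      (∀ {x} → x ∈ xs ⇔ x ∈ ys) → (f : A → ℕ) → ∑ xs f ≡ ∑ ys f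
    ∑-sameElements xs! ys! same f = sum-↭ (Perm.map⁺ f (∼bag⇒↭ (unique∧set⇒bag xs! ys! same)))

    -- Often read from right to left, to split a count according to the value of `a`.
    ∑-δ : (_≟_ : DecidableEquality A) {xs : List A} {a : A} → Unique xs → a ∈ xs →
      (f : A → ℕ) → ∑ xs (λ x → χ (a ≟ x) * f x) ≡ f a
    ∑-δ _≟_ {x ∷ xs} {a} (x∉xs ∷ xs!) (here refl) f = trans
      (cong₂ _+_ (cong (_* f a) (χ-true (a ≟ a) refl))
                 (trans (∑-cong-∈ xs (λ {y} y∈xs → cong (_* f y) (χ-false (a ≟ y) (All.lookup x∉xs y∈xs))))
                        (∑-0 xs)))
      (trans (+-identityʳ _) (*-identityˡ (f a)))
    ∑-δ _≟_ {x ∷ xs} {a} (x∉xs ∷ xs!) (there a∈xs) f = trans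
      (cong (λ b → b * f x + ∑ xs (λ y → χ (a ≟ y) * f y)) (χ-false (a ≟ x) (λ { refl → All.lookup x∉xs a∈xs refl })))
      (∑-δ _≟_ xs! a∈xs f)

  ∑-comm : {A B : Set} (xs : List A) (ys : List B) (f : A → B → ℕ) →
    ∑ xs (λ x → ∑ ys (f x)) ≡ ∑ ys (λ y → ∑ xs (λ x → f x y))
  ∑-comm []       ys f = sym (∑-0 ys)
  ∑-comm (x ∷ xs) ys f = trans (cong (∑ ys (f x) +_) (∑-comm xs ys f)) (sym (∑-+ ys (f x) _))

  ∑-map : {A B : Set} (g : A → B) (xs : List A) (f : B → ℕ) → ∑ (map g xs) f ≡ ∑ xs (f ∘ g)
  ∑-map g []       f = refl
  ∑-map g (x ∷ xs) f = cong (f (g x) +_) (∑-map g xs f)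

  ∑-++ : {A : Set} (xs ys : List A) (f : A → ℕ) → ∑ (xs ++ ys) f ≡ ∑ xs f + ∑ ys f
  ∑-++ []       ys f = refl
  ∑-++ (x ∷ xs) ys f = trans (cong (f x +_) (∑-++ xs ys f)) (sym (+-assoc (f x) (∑ xs f) (∑ ys f)))

  ∑-product : {A B C : Set} (g : A → B → C) (xs : List A) (ys : List B) (f : C → ℕ) →
    ∑ (cartesianProductWith g xs ys) f ≡ ∑ xs (λ x → ∑ ys (λ y → f (g x y)))
  ∑-product g []       ys f = refl
  ∑-product g (x ∷ xs) ys f = trans (∑-++ (map (g x) ys) (cartesianProductWith g xs ys) f)
    (cong₂ _+_ (∑-map (g x) ys f) (∑-product g xs ys f))

  vectors : {A : Set} (n : ℕ) → List A → List (Vec A n)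
  vectors zero    as = [] ∷ []
  vectors (suc n) as = cartesianProductWith _∷_ as (vectors n as)

  module _ {A : Set} {as : List A} where

    vectors-unique : ∀ n → Unique as → Unique (vectors n as)
    vectors-unique zero    as! = All.[] ∷ []
    vectors-unique (suc n) as! = Unique.cartesianProductWith⁺ _∷_ Vec.∷-injective as! (vectors-unique n as!)

    ∈-vectors⁺ : ∀ {n} {v : Vec A n} → VecAll.All (_∈ as) v → v ∈ vectors n as
    ∈-vectors⁺ []       = here refl
    ∈-vectors⁺ (p ∷ ps) = ∈-cartesianProductWith⁺ _∷_ p (∈-vectors⁺ ps)

    ∈-vectors⁻ : ∀ n {v : Vec A n} → v ∈ vectors n as → VecAll.All (_∈ as) v
    ∈-vectors⁻ zero    {[]} _ = []
    ∈-vectors⁻ (suc n) v∈ with ∈-cartesianProductWith⁻ _∷_ as (vectors n as) v∈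
    ... | _ , _ , a∈ , w∈ , refl = a∈ ∷ ∈-vectors⁻ n w∈

  ∑-vectors-1 : {A : Set} (as : List A) → ∀ n → ∑ (vectors n as) (λ _ → 1) ≡ length as ^ n
  ∑-vectors-1 as zero    = refl
  ∑-vectors-1 as (suc n) = trans (∑-product _∷_ as (vectors n as) _)
    (trans (∑-cong as (λ _ → ∑-vectors-1 as n)) (∑-const as (length as ^ n)))

  -- Overwriting coordinate k by b forgets it, so each vector with k-th entry b is hit length as times.
  ∑-update : {A : Set} (_≟_ : DecidableEquality A) {as : List A} → Unique as →
    ∀ {n} (k : Fin n) {b : A} → b ∈ as → (f : Vec A n → ℕ) →
    ∑ (vectors n as) (λ v → f (v [ k ]≔ b)) ≡ length as * ∑ (vectors n as) (λ v → χ (b ≟ lookup v k) * f v)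
  ∑-update _≟_ {as} as! {suc n} Fin.zero {b} b∈as f = begin
      ∑ (vectors (suc n) as) (λ v → f (v [ Fin.zero ]≔ b))
        ≡⟨ ∑-product _∷_ as vs _ ⟩
      ∑ as (λ _ → ∑ vs (λ v → f (b ∷ v)))
        ≡⟨ ∑-const as _ ⟩
      length as * ∑ vs (λ v → f (b ∷ v))
        ≡⟨ cong (length as *_) (sym (∑-δ _≟_ as! b∈as (λ a → ∑ vs (λ v → f (a ∷ v))))) ⟩
      length as * ∑ as (λ a → χ (b ≟ a) * ∑ vs (λ v → f (a ∷ v)))
        ≡⟨ cong (length as *_) (∑-cong as (λ a → sym (∑-*ˡ vs (χ (b ≟ a)) (λ v → f (a ∷ v))))) ⟩
      length as * ∑ as (λ a → ∑ vs (λ v → χ (b ≟ a) * f (a ∷ v)))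
        ≡⟨ cong (length as *_) (sym (∑-product _∷_ as vs _)) ⟩
      length as * ∑ (vectors (suc n) as) (λ v → χ (b ≟ lookup v Fin.zero) * f v) ∎
    where
    open ≡-Reasoning
    vs = vectors n as
  ∑-update _≟_ {as} as! {suc n} (Fin.suc k) {b} b∈as f = begin
      ∑ (vectors (suc n) as) (λ v → f (v [ Fin.suc k ]≔ b))
        ≡⟨ ∑-product _∷_ as vs _ ⟩
      ∑ as (λ a → ∑ vs (λ v → f (a ∷ (v [ k ]≔ b))))
        ≡⟨ ∑-cong as (λ a → ∑-update _≟_ as! k b∈as (λ v → f (a ∷ v))) ⟩
      ∑ as (λ a → length as * ∑ vs (λ v → χ (b ≟ lookup v k) * f (a ∷ v)))
        ≡⟨ ∑-*ˡ as (length as) _ ⟩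
      length as * ∑ as (λ a → ∑ vs (λ v → χ (b ≟ lookup v k) * f (a ∷ v)))
        ≡⟨ cong (length as *_) (sym (∑-product _∷_ as vs _)) ⟩
      length as * ∑ (vectors (suc n) as) (λ v → χ (b ≟ lookup v (Fin.suc k)) * f v) ∎
    where
    open ≡-Reasoning
    vs = vectors n as

open FiniteSums

-- Counting tuples of tables by their action on tuples of distinct points.

module Tables where

  open import Data.List.Properties using (length-tabulate)
  open import Data.List.Relation.Unary.Unique.Propositional using () renaming (Unique to Uniqueᴸ)
  import Data.List.Relation.Unary.Unique.Propositional.Properties as Uniqueᴸ
  open import Data.Nat
  open import Data.Nat.Properties
  open import Data.Unit using (tt)
  open import Data.Vec.Relation.Unary.All as All using (All; []; _∷_)
  import Data.Vec.Relation.Unary.All.Properties as All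
  open import Data.Vec.Relation.Unary.AllPairs using (allPairs?; []; _∷_)
  open import Data.Vec.Relation.Unary.Unique.Propositional using (Unique)

  -- The falling factorial. For `k > m` a factor 0 occurs, so it vanishes without a case
  -- distinction.
  fall : ℕ → ℕ → ℕ
  fall m zero    = 1
  fall m (suc k) = m * fall (pred m) k

  length-allFin : ∀ n → length (allFin n) ≡ n
  length-allFin n = length-tabulate {n = n} (λ a → a)

  map⁻-unique : {A B : Set} (f : A → B) → ∀ {n} {v : Vec A n} → Unique (Vec.map f v) → Unique v
  map⁻-unique f {v = []}    []       = []
  map⁻-unique f {v = x ∷ v} (p ∷ ps) = All.map (λ fx≢fy x≡y → fx≢fy (cong f x≡y)) (All.map⁻ p) ∷ map⁻-unique f ps

  module _ {A : Set} (_≟_ : DecidableEquality A) where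

    unique? : ∀ {n} → Decidable (Unique {A = A} {n})
    unique? = allPairs? (λ x y → ¬? (x ≟ y))

    module _ {as : List A} (as! : Uniqueᴸ as) where

      ∑-remove : {P : Pred A 0ℓ} (P? : Decidable P) {a : A} → a ∈ as → P a →
        ∑ as (λ b → χ (P? b ×-dec ¬? (a ≟ b))) ≡ pred (∑ as (λ b → χ (P? b)))
      ∑-remove P? {a} a∈as Pa = cong pred (begin
          1 + ∑ as (λ b → χ (P? b ×-dec ¬? (a ≟ b)))
            ≡⟨ cong (_+ ∑ as (λ b → χ (P? b ×-dec ¬? (a ≟ b))))
                 (sym (trans (∑-δ _≟_ as! a∈as (λ b → χ (P? b))) (χ-true (P? a) Pa))) ⟩
          ∑ as (λ b → χ (a ≟ b) * χ (P? b)) + ∑ as (λ b → χ (P? b ×-dec ¬? (a ≟ b)))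
            ≡⟨ sym (∑-+ as _ _) ⟩
          ∑ as (λ b → χ (a ≟ b) * χ (P? b) + χ (P? b ×-dec ¬? (a ≟ b)))
            ≡⟨ ∑-cong as split ⟩
          ∑ as (λ b → χ (P? b)) ∎)
        where
        open ≡-Reasoning
        split : ∀ b → χ (a ≟ b) * χ (P? b) + χ (P? b ×-dec ¬? (a ≟ b)) ≡ χ (P? b)
        split b with a ≟ b | P? b
        ... | yes _ | yes _ = refl
        ... | yes _ | no _  = refl
        ... | no _  | yes _ = refl
        ... | no _  | no _  = refl

      -- Once the first entry `a` is chosen, the others must satisfy `P` and avoid `a`, a predicate
      -- with one solution fewer. The induction therefore needs an arbitrary `P`.
      count-unique : ∀ k {P : Pred A 0ℓ} (P? : Decidable P) →
        ∑ (vectors k as) (λ v → χ (unique? v) * χ (All.all? P? v)) ≡ fall (∑ as (λ a → χ (P? a))) k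
      count-unique zero    P? = refl
      count-unique (suc k) {P} P? = begin
          ∑ (vectors (suc k) as) (λ v → χ (unique? v) * χ (All.all? P? v))
            ≡⟨ ∑-product _∷_ as vs _ ⟩
          ∑ as (λ a → ∑ vs (λ v → χ (unique? (a ∷ v)) * χ (All.all? P? (a ∷ v))))
            ≡⟨ ∑-cong as (λ a → trans (∑-cong vs (split a)) (∑-*ˡ vs (χ (P? a)) _)) ⟩
          ∑ as (λ a → χ (P? a) * ∑ vs (λ v → χ (unique? v) * χ (All.all? (P∖? a) v)))
            ≡⟨ ∑-cong as (λ a → cong (χ (P? a) *_) (count-unique k (P∖? a))) ⟩
          ∑ as (λ a → χ (P? a) * fall (∑ as (λ b → χ (P∖? a b))) k)
            ≡⟨ ∑-cong-∈ as (λ {a} a∈as → χ-restrict (P? a) (λ Pa → cong (λ m → fall m k) (∑-remove P? a∈as Pa))) ⟩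
          ∑ as (λ a → χ (P? a) * fall (pred (∑ as (λ b → χ (P? b)))) k)
            ≡⟨ ∑-*ʳ as _ _ ⟩
          fall (∑ as (λ a → χ (P? a))) (suc k) ∎
        where
        open ≡-Reasoning
        vs = vectors k as
        P∖? : ∀ a → Decidable (λ b → P b × a ≢ b)
        P∖? a b = P? b ×-dec ¬? (a ≟ b)
        split : ∀ a v → χ (unique? (a ∷ v)) * χ (All.all? P? (a ∷ v)) ≡
                        χ (P? a) * (χ (unique? v) * χ (All.all? (P∖? a) v))
        split a v = begin
          χ (unique? (a ∷ v)) * χ (All.all? P? (a ∷ v))
            ≡⟨ sym (χ-× (unique? (a ∷ v)) (All.all? P? (a ∷ v))) ⟩
          χ (unique? (a ∷ v) ×-dec All.all? P? (a ∷ v))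
            ≡⟨ χ-cong (unique? (a ∷ v) ×-dec All.all? P? (a ∷ v)) (P? a ×-dec (unique? v ×-dec All.all? (P∖? a) v))
                 (λ { (a∉v ∷ v! , Pa ∷ Pv) → Pa , v! , All.zip (Pv , a∉v) })
                 (λ { (Pa , v! , Q) → proj₂ (All.unzip Q) ∷ v! , Pa ∷ proj₁ (All.unzip Q) }) ⟩
          χ (P? a ×-dec (unique? v ×-dec All.all? (P∖? a) v))
            ≡⟨ trans (χ-× (P? a) _) (cong (χ (P? a) *_) (χ-× (unique? v) _)) ⟩
          χ (P? a) * (χ (unique? v) * χ (All.all? (P∖? a) v)) ∎

  Table : ℕ → Set
  Table q = Vec (Fin q) q

  _≟ᵛ_ : ∀ {n q} → DecidableEquality (Vec (Fin q) n)
  _≟ᵛ_ = Vec.≡-dec Fin._≟_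

  tables : ∀ q → List (Table q)
  tables q = vectors q (allFin q)

  points : ∀ k q → List (Vec (Fin q) k)
  points k q = vectors k (allFin q)

  points-unique : ∀ k q → Uniqueᴸ (points k q)
  points-unique k q = vectors-unique k (Uniqueᴸ.allFin⁺ q)

  ∈-points : ∀ {k q} (v : Vec (Fin q) k) → v ∈ points k q
  ∈-points v = ∈-vectors⁺ (All.universal ∈-allFin v)

  -- Each prescribed value divides the count by `q`: by `∑-update`, prescribing the entry at `a` is
  -- overwriting it, and this leaves the conditions at the other points alone because they differ
  -- from `a`. The product form avoids the exponent `q ∸ k`.
  count-tables : ∀ {k q} {x y : Vec (Fin q) k} → Unique x →
    q ^ k * ∑ (tables q) (λ g → χ (Vec.map (lookup g) x ≟ᵛ y)) ≡ q ^ q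
  count-tables {q = q} {[]} {[]} [] = trans (*-identityˡ _)
    (trans (∑-vectors-1 (allFin q) q) (cong (_^ q) (length-allFin q)))
  count-tables {suc k} {q} {a ∷ x} {b ∷ y} (a∉x ∷ x!) = begin
      q ^ suc k * ∑ (tables q) (λ g → χ (Vec.map (lookup g) (a ∷ x) ≟ᵛ (b ∷ y)))
        ≡⟨ trans (cong (_* s) (*-comm q (q ^ k))) (*-assoc (q ^ k) q s) ⟩
      q ^ k * (q * ∑ (tables q) (λ g → χ (Vec.map (lookup g) (a ∷ x) ≟ᵛ (b ∷ y))))
        ≡⟨ cong (λ m → q ^ k * (q * m)) (∑-cong (tables q) split) ⟩
      q ^ k * (q * ∑ (tables q) (λ g → χ (b Fin.≟ lookup g a) * through g))
        ≡⟨ cong (λ m → q ^ k * (m * ∑ (tables q) (λ g → χ (b Fin.≟ lookup g a) * through g)))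
             (sym (length-allFin q)) ⟩
      q ^ k * (length (allFin q) * ∑ (tables q) (λ g → χ (b Fin.≟ lookup g a) * through g))
        ≡⟨ cong (q ^ k *_) (sym (∑-update Fin._≟_ (Uniqueᴸ.allFin⁺ q) a (∈-allFin b) through)) ⟩
      q ^ k * ∑ (tables q) (λ g → through (g [ a ]≔ b))
        ≡⟨ cong (q ^ k *_) (∑-cong (tables q) (λ g → cong (λ z → χ (z ≟ᵛ y)) (unaffected g a∉x))) ⟩
      q ^ k * ∑ (tables q) through
        ≡⟨ count-tables x! ⟩
      q ^ q ∎
    where
    open ≡-Reasoning
    through : Table q → ℕ
    through g = χ (Vec.map (lookup g) x ≟ᵛ y)
    s = ∑ (tables q) (λ g → χ (Vec.map (lookup g) (a ∷ x) ≟ᵛ (b ∷ y)))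
    split : ∀ g → χ (Vec.map (lookup g) (a ∷ x) ≟ᵛ (b ∷ y)) ≡ χ (b Fin.≟ lookup g a) * through g
    split g = trans
      (χ-cong (Vec.map (lookup g) (a ∷ x) ≟ᵛ (b ∷ y)) ((b Fin.≟ lookup g a) ×-dec (Vec.map (lookup g) x ≟ᵛ y))
        (λ eq → sym (Vec.∷-injectiveˡ eq) , Vec.∷-injectiveʳ eq) (λ (p , r) → cong₂ _∷_ (sym p) r))
      (χ-× (b Fin.≟ lookup g a) _)
    unaffected : ∀ g {j} {z : Vec (Fin q) j} → All (a ≢_) z → Vec.map (lookup (g [ a ]≔ b)) z ≡ Vec.map (lookup g) z
    unaffected g []                 = refl
    unaffected g (_∷_ {x = c} a≢c ps) = cong₂ _∷_ (Vec.lookup∘update′ (a≢c ∘ sym) g b) (unaffected g ps)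

  comp : ∀ {n q} → Vec (Table q) n → Fin q → Fin q
  comp []       a = a
  comp (h ∷ hs) a = comp hs (lookup h a)

  fixedPoints : ∀ {n q} → Vec (Table q) n → ℕ
  fixedPoints {q = q} hs = ∑ (allFin q) (λ a → χ (comp hs a Fin.≟ a))

  fixedPoints≤q : ∀ {n q} (hs : Vec (Table q) n) → fixedPoints hs ≤ q
  fixedPoints≤q {q = q} hs = ≤-trans (∑-mono (allFin q) (λ a → χ-≤1 (comp hs a Fin.≟ a)))
    (≤-reflexive (trans (∑-1 (allFin q)) (length-allFin q)))

  -- The number `c` of nonconstant tables carrying one distinct `k`-tuple to another has different
  -- forms for `k = 0`, `k = 1` and `k ≥ 2`. All that matters here is that it is the same for all
  -- pairs of tuples.
  module _ {q : ℕ} (gs : List (Table q)) (k c : ℕ)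
    (count-gs : ∀ {x y : Vec (Fin q) k} → Unique x → Unique y → ∑ gs (λ g → χ (Vec.map (lookup g) x ≟ᵛ y)) ≡ c)
    where

    private
      uniqueᵛ : Vec (Fin q) k → ℕ
      uniqueᵛ x = χ (unique? Fin._≟_ x)

      T : ∀ n → Vec (Fin q) k → Vec (Fin q) k → ℕ
      T n x z = ∑ (vectors n gs) (λ hs → χ (Vec.map (comp hs) x ≟ᵛ z))

      -- Counts the ways to reach `z`: a starting tuple of distinct points together with `n` tables
      -- whose composition carries it to `z`.
      U : ∀ n → Vec (Fin q) k → ℕ
      U n z = ∑ (points k q) (λ x → uniqueᵛ x * T n x z)

      T-nonunique : ∀ n {x z} → Unique z → ¬ Unique x → T n x z ≡ 0
      T-nonunique n {x} {z} z! ¬x! = trans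
        (∑-cong (vectors n gs) (λ hs → χ-false (Vec.map (comp hs) x ≟ᵛ z)
          (λ eq → ¬x! (map⁻-unique (comp hs) (subst Unique (sym eq) z!)))))
        (∑-0 (vectors n gs))

      -- Split by the image `y` of `x` under the first table. If `y` has a repetition, no
      -- composition carries it to the distinct tuple `z`; otherwise `c` tables carry `x` to `y`.
      T-suc : ∀ n {x z} → Unique x → Unique z → T (suc n) x z ≡ c * U n z
      T-suc n {x} {z} x! z! = begin
          T (suc n) x z
            ≡⟨ ∑-product _∷_ gs (vectors n gs) _ ⟩
          ∑ gs (λ g → ∑ (vectors n gs) (λ hs → χ (Vec.map (comp (g ∷ hs)) x ≟ᵛ z)))
            ≡⟨ ∑-cong gs (λ g → ∑-cong (vectors n gs) (λ hs →
                 cong (λ w → χ (w ≟ᵛ z)) (Vec.map-∘ (comp hs) (lookup g) x))) ⟩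
          ∑ gs (λ g → T n (Vec.map (lookup g) x) z)
            ≡⟨ ∑-cong gs (λ g → sym (∑-δ _≟ᵛ_ (points-unique k q) (∈-points (Vec.map (lookup g) x)) (λ y → T n y z))) ⟩
          ∑ gs (λ g → ∑ (points k q) (λ y → χ (Vec.map (lookup g) x ≟ᵛ y) * T n y z))
            ≡⟨ ∑-comm gs (points k q) _ ⟩
          ∑ (points k q) (λ y → ∑ gs (λ g → χ (Vec.map (lookup g) x ≟ᵛ y) * T n y z))
            ≡⟨ ∑-cong (points k q) (λ y → ∑-*ʳ gs (T n y z) _) ⟩
          ∑ (points k q) (λ y → ∑ gs (λ g → χ (Vec.map (lookup g) x ≟ᵛ y)) * T n y z)
            ≡⟨ ∑-cong (points k q) step ⟩
          ∑ (points k q) (λ y → c * (uniqueᵛ y * T n y z))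
            ≡⟨ ∑-*ˡ (points k q) c _ ⟩
          c * U n z ∎
        where
        open ≡-Reasoning
        step : ∀ y → ∑ gs (λ g → χ (Vec.map (lookup g) x ≟ᵛ y)) * T n y z ≡ c * (uniqueᵛ y * T n y z)
        step y with unique? Fin._≟_ y
        ... | yes y! = cong₂ _*_ (count-gs x! y!) (sym (*-identityˡ (T n y z)))
        ... | no ¬y! = trans (cong (s *_) (T-nonunique n z! ¬y!)) (trans (*-zeroʳ s) (sym (*-zeroʳ c)))
          where s = ∑ gs (λ g → χ (Vec.map (lookup g) x ≟ᵛ y))

      count-all : ∑ (points k q) uniqueᵛ ≡ fall q k
      count-all = begin
          ∑ (points k q) uniqueᵛ
            ≡⟨ ∑-cong (points k q) (λ x → sym (trans
                 (cong (uniqueᵛ x *_) (χ-true (All.all? (λ _ → yes tt) x) (All.universal (λ _ → tt) x)))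
                 (*-identityʳ (uniqueᵛ x)))) ⟩
          ∑ (points k q) (λ x → uniqueᵛ x * χ (All.all? (λ _ → yes tt) x))
            ≡⟨ count-unique Fin._≟_ (Uniqueᴸ.allFin⁺ q) k (λ _ → yes tt) ⟩
          fall (∑ (allFin q) (λ _ → 1)) k
            ≡⟨ cong (λ m → fall m k) (trans (∑-1 (allFin q)) (length-allFin q)) ⟩
          fall q k ∎
        where open ≡-Reasoning

      -- Serves two targets: a constant `f` gives the recursion for `U`, and the identity closes the
      -- cycle in `factorialMoment`.
      ∑-T-suc : ∀ n {z} (f : Vec (Fin q) k → Vec (Fin q) k) → (∀ {x} → Unique x → Unique (f x)) →
        (∀ x → Unique x → U n (f x) ≡ z) →
        ∑ (points k q) (λ x → uniqueᵛ x * T (suc n) x (f x)) ≡ fall q k * (c * z)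
      ∑-T-suc n {z} f f! eq = begin
          ∑ (points k q) (λ x → uniqueᵛ x * T (suc n) x (f x))
            ≡⟨ ∑-cong (points k q) (λ x → χ-restrict (unique? Fin._≟_ x)
                 (λ x! → trans (T-suc n x! (f! x!)) (cong (c *_) (eq x x!)))) ⟩
          ∑ (points k q) (λ x → uniqueᵛ x * (c * z))
            ≡⟨ trans (∑-*ʳ (points k q) (c * z) uniqueᵛ) (cong (_* (c * z)) count-all) ⟩
          fall q k * (c * z) ∎
        where open ≡-Reasoning

      -- Every table contributes a choice of the distinct tuple it starts from and a choice of the
      -- table itself. The value is independent of `z`, so the target may later be the starting
      -- tuple.
      U-eq : ∀ n {z} → Unique z → U n z ≡ (fall q k * c) ^ n
      U-eq zero {z} z! = begin
          ∑ (points k q) (λ x → uniqueᵛ x * (χ (Vec.map (λ a → a) x ≟ᵛ z) + 0))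
            ≡⟨ ∑-cong (points k q) (λ x → trans (*-comm (uniqueᵛ x) _) (cong (_* uniqueᵛ x) (trans (+-identityʳ _)
                 (χ-cong (Vec.map (λ a → a) x ≟ᵛ z) (z ≟ᵛ x)
                   (λ eq → trans (sym eq) (Vec.map-id x)) (λ eq → trans (Vec.map-id x) (sym eq)))))) ⟩
          ∑ (points k q) (λ x → χ (z ≟ᵛ x) * uniqueᵛ x)
            ≡⟨ ∑-δ _≟ᵛ_ (points-unique k q) (∈-points z) uniqueᵛ ⟩
          uniqueᵛ z
            ≡⟨ χ-true (unique? Fin._≟_ z) z! ⟩
          1 ∎
        where open ≡-Reasoning
      U-eq (suc n) {z} z! = trans (∑-T-suc n (λ _ → z) (λ _ → z!) (λ _ _ → U-eq n z!))
        (sym (*-assoc (fall q k) c _))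

    -- The falling factorial counts tuples of distinct fixed points, that is, distinct tuples
    -- carried to themselves. At least one table is required: the empty composition fixes every
    -- point.
    factorialMoment : ∀ n → ∑ (vectors (suc n) gs) (λ hs → fall (fixedPoints hs) k) ≡ (fall q k * c) ^ suc n
    factorialMoment n = begin
        ∑ (vectors (suc n) gs) (λ hs → fall (fixedPoints hs) k)
          ≡⟨ ∑-cong (vectors (suc n) gs) (λ hs →
               sym (count-unique Fin._≟_ (Uniqueᴸ.allFin⁺ q) k (λ a → comp hs a Fin.≟ a))) ⟩
        ∑ (vectors (suc n) gs) (λ hs → ∑ (points k q) (λ x → uniqueᵛ x * χ (All.all? (λ a → comp hs a Fin.≟ a) x)))
          ≡⟨ ∑-comm (vectors (suc n) gs) (points k q) _ ⟩
        ∑ (points k q) (λ x → ∑ (vectors (suc n) gs) (λ hs → uniqueᵛ x * χ (All.all? (λ a → comp hs a Fin.≟ a) x)))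
          ≡⟨ ∑-cong (points k q) (λ x → ∑-*ˡ (vectors (suc n) gs) (uniqueᵛ x) _) ⟩
        ∑ (points k q) (λ x → uniqueᵛ x * ∑ (vectors (suc n) gs) (λ hs → χ (All.all? (λ a → comp hs a Fin.≟ a) x)))
          ≡⟨ ∑-cong (points k q) (λ x → cong (uniqueᵛ x *_) (∑-cong (vectors (suc n) gs) (λ hs →
               χ-cong (All.all? (λ a → comp hs a Fin.≟ a) x) (Vec.map (comp hs) x ≟ᵛ x) (all⇒map hs) (map⇒all hs x)))) ⟩
        ∑ (points k q) (λ x → uniqueᵛ x * T (suc n) x x)
          ≡⟨ ∑-T-suc n (λ x → x) (λ x! → x!) (λ _ x! → U-eq n x!) ⟩
        fall q k * (c * (fall q k * c) ^ n)
          ≡⟨ sym (*-assoc (fall q k) c _) ⟩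
        (fall q k * c) ^ suc n ∎
      where
      open ≡-Reasoning
      all⇒map : ∀ {n} (hs : Vec (Table q) n) {j} {x : Vec (Fin q) j} → All (λ a → comp hs a ≡ a) x → Vec.map (comp hs) x ≡ x
      all⇒map hs []       = refl
      all⇒map hs (p ∷ ps) = cong₂ _∷_ p (all⇒map hs ps)
      map⇒all : ∀ {n} (hs : Vec (Table q) n) {j} (x : Vec (Fin q) j) → Vec.map (comp hs) x ≡ x → All (λ a → comp hs a ≡ a) x
      map⇒all hs []      _  = []
      map⇒all hs (a ∷ x) eq = Vec.∷-injectiveˡ eq ∷ map⇒all hs x (Vec.∷-injectiveʳ eq)

  -- Nonconstant tables with prescribed values.

  Nonconstant : ∀ {q} → Pred (Table q) 0ℓ
  Nonconstant g = ∃[ a ] ∃[ b ] lookup g a ≢ lookup g b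

  nonconstant? : ∀ {q} → Decidable (Nonconstant {q})
  nonconstant? g = Fin.any? λ a → Fin.any? λ b → ¬? (lookup g a Fin.≟ lookup g b)

  nonconstants : ∀ q → List (Table q)
  nonconstants q = filter nonconstant? (tables q)

  -- Two distinct prescribed values already exclude the constant tables, so the count is that of all
  -- tables.
  count-nonconstants≥2 : ∀ {k q} {x y : Vec (Fin q) (2 + k)} → Unique x → Unique y →
    q ^ (2 + k) * ∑ (nonconstants q) (λ g → χ (Vec.map (lookup g) x ≟ᵛ y)) ≡ q ^ q
  count-nonconstants≥2 {k} {q} {x@(a ∷ b ∷ _)} {y} x! y! = trans
    (cong (q ^ (2 + k) *_) (trans (∑-filter nonconstant? (tables q) _) (∑-cong (tables q) (λ g →
      sym (χ-absorb (nonconstant? g) (λ ¬nc → χ-false (Vec.map (lookup g) x ≟ᵛ y) (λ eq → ¬nc (a , b , differ g eq y!))))))))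
    (count-tables x!)
    where
    differ : ∀ g {y} → Vec.map (lookup g) x ≡ y → Unique y → lookup g a ≢ lookup g b
    differ g refl ((p ∷ _) ∷ _) = p

  -- The successor restores the one constant table with value `b` at `a`, namely `replicate q b`.
  count-nonconstants-1 : ∀ {q} (a b : Fin q) →
    q * suc (∑ (nonconstants q) (λ g → χ (Vec.map (lookup g) (a ∷ []) ≟ᵛ (b ∷ [])))) ≡ q ^ q
  count-nonconstants-1 {q} a b = trans (cong₂ _*_ (sym (*-identityʳ q)) (begin
      suc (∑ (nonconstants q) through)
        ≡⟨ cong₂ _+_ (sym (trans (∑-cong (tables q) constant) (∑-δ _≟ᵛ_ (points-unique q q) (∈-points (replicate q b)) (λ _ → 1))))
                     (∑-filter nonconstant? (tables q) through) ⟩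
      ∑ (tables q) (λ g → χ (¬? (nonconstant? g)) * through g) + ∑ (tables q) (λ g → χ (nonconstant? g) * through g)
        ≡⟨ sym (∑-+ (tables q) _ _) ⟩
      ∑ (tables q) (λ g → χ (¬? (nonconstant? g)) * through g + χ (nonconstant? g) * through g)
        ≡⟨ ∑-cong (tables q) split ⟩
      ∑ (tables q) through ∎)) (count-tables {x = a ∷ []} {b ∷ []} ([] ∷ []))
    where
    open ≡-Reasoning
    through : Table q → ℕ
    through g = χ (Vec.map (lookup g) (a ∷ []) ≟ᵛ (b ∷ []))
    split : ∀ g → χ (¬? (nonconstant? g)) * through g + χ (nonconstant? g) * through g ≡ through g
    split g with nonconstant? g
    ... | yes _ = *-identityˡ (through g)
    ... | no _  = trans (+-identityʳ _) (*-identityˡ (through g))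
    const : ∀ g → ¬ Nonconstant g → ∀ c → lookup g c ≡ lookup g a
    const g ¬nc c with lookup g c Fin.≟ lookup g a
    ... | yes eq = eq
    ... | no neq = contradiction (c , a , neq) ¬nc
    constant : ∀ g → χ (¬? (nonconstant? g)) * through g ≡ χ (replicate q b ≟ᵛ g) * 1
    constant g = trans (sym (χ-× (¬? (nonconstant? g)) (Vec.map (lookup g) (a ∷ []) ≟ᵛ (b ∷ []))))
      (trans (χ-cong (¬? (nonconstant? g) ×-dec (Vec.map (lookup g) (a ∷ []) ≟ᵛ (b ∷ []))) (replicate q b ≟ᵛ g)
        (λ (¬nc , ga≡b) → sym (trans (sym (Vec.tabulate∘lookup g)) (trans
           (Vec.tabulate-cong (λ c → trans (const g ¬nc c) (Vec.∷-injectiveˡ ga≡b))) tabulate-const)))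
        (λ { refl → (λ (c , d , neq) → neq (trans (Vec.lookup-replicate c b) (sym (Vec.lookup-replicate d b))))
                  , cong (_∷ []) (Vec.lookup-replicate a b) }))
      (sym (*-identityʳ _)))
      where
      tabulate-const : ∀ {m} → tabulate {n = m} (λ _ → b) ≡ replicate m b
      tabulate-const {zero}  = refl
      tabulate-const {suc m} = cong (b ∷_) tabulate-const

open Tables

-- Estimates for the factorial moments.

module Moments where

  open import Data.Nat
  open import Data.Nat.Properties
  open import Data.Nat.Tactic.RingSolver using (solve-∀)
  open import Data.Vec.Relation.Unary.All using ([]; _∷_)
  open import Data.Vec.Relation.Unary.AllPairs using ([]; _∷_)

  fall-sucʳ : ∀ m k → fall m (suc k) ≡ fall m k * (m ∸ k)
  fall-sucʳ m zero    = trans (*-identityʳ m) (sym (*-identityˡ m))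
  fall-sucʳ m (suc k) = begin
      m * fall (pred m) (suc k)
        ≡⟨ cong (m *_) (fall-sucʳ (pred m) k) ⟩
      m * (fall (pred m) k * (pred m ∸ k))
        ≡⟨ sym (*-assoc m _ _) ⟩
      m * fall (pred m) k * (pred m ∸ k)
        ≡⟨ cong (m * fall (pred m) k *_) (pred∸ m) ⟩
      fall m (suc k) * (m ∸ suc k) ∎
    where
    open ≡-Reasoning
    pred∸ : ∀ m → pred m ∸ k ≡ m ∸ suc k
    pred∸ zero    = 0∸n≡0 k
    pred∸ (suc m) = refl

  fall-zero : ∀ m {k} → m < k → fall m k ≡ 0
  fall-zero zero    {suc k} _         = refl
  fall-zero (suc m) {suc k} (s≤s m<k) = trans (cong (suc m *_) (fall-zero m m<k)) (*-zeroʳ (suc m))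

  fall≤^ : ∀ m k → fall m k ≤ m ^ k
  fall≤^ m zero    = ≤-refl
  fall≤^ m (suc k) = *-monoʳ-≤ m (≤-trans (fall≤^ (pred m) k) (^-monoˡ-≤ k pred[n]≤n))

  -- Replacing the factor `m` by `m ∸ k` costs at most `k * m ^ k`. Relative to the power these
  -- costs are `0, 1, …, k - 1` in units of `1 / m`; their sum is at most `k * pred k`.
  ^≤fall : ∀ m k → m * m ^ k ≤ m * fall m k + k * pred k * m ^ k
  ^≤fall m zero    = m≤m+n (m * 1) 0
  ^≤fall m (suc k) = begin
      m * (m * m ^ k)
        ≤⟨ *-monoʳ-≤ m (^≤fall m k) ⟩
      m * (m * fall m k + k * pred k * m ^ k)
        ≤⟨ *-monoʳ-≤ m (+-mono-≤ step (*-monoˡ-≤ (m ^ k) (*-monoʳ-≤ k (pred[n]≤n {k})))) ⟩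
      m * (fall m (suc k) + k * m ^ k + k * k * m ^ k)
        ≡⟨ rearrange m (fall m (suc k)) k (m ^ k) ⟩
      m * fall m (suc k) + suc k * k * (m * m ^ k) ∎
    where
    open ≤-Reasoning
    rearrange : ∀ m f k p → m * (f + k * p + k * k * p) ≡ m * f + suc k * k * (m * p)
    rearrange = solve-∀
    step : m * fall m k ≤ fall m (suc k) + k * m ^ k
    step = begin
      m * fall m k                            ≤⟨ *-monoˡ-≤ (fall m k) (m≤n+m∸n m k) ⟩
      (k + (m ∸ k)) * fall m k                ≡⟨ *-distribʳ-+ (fall m k) k (m ∸ k) ⟩
      k * fall m k + (m ∸ k) * fall m k       ≡⟨ cong (k * fall m k +_) (trans (*-comm (m ∸ k) _) (sym (fall-sucʳ m k))) ⟩
      k * fall m k + fall m (suc k)           ≤⟨ +-monoˡ-≤ _ (*-monoʳ-≤ k (fall≤^ m k)) ⟩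
      k * m ^ k + fall m (suc k)              ≡⟨ +-comm (k * m ^ k) _ ⟩
      fall m (suc k) + k * m ^ k              ∎

  ∣-∣≤ : ∀ {m n o} → m ≤ n + o → n ≤ m + o → ∣ m - n ∣ ≤ o
  ∣-∣≤ {m} {n} {o} m≤ n≤ with ≤-total m n
  ... | inj₁ m≤n = ≤-trans (≤-reflexive (m≤n⇒∣m-n∣≡n∸m m≤n)) (m≤n+o⇒m∸n≤o n m n≤)
  ... | inj₂ n≤m = ≤-trans (≤-reflexive (m≤n⇒∣n-m∣≡n∸m n≤m)) (m≤n+o⇒m∸n≤o m n m≤)

  -- Telescoping through `x * y ^ n`, the relative error `e` becomes at most `2 * e + E`, as
  -- `x ≤ 2 * y`. The factor `3 ^ n` absorbs this because `2 * 3 ^ n + 1 ≤ 3 * 3 ^ n`.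
  ^-close : ∀ q E {x y} → x ≤ 2 * y → q * ∣ x - y ∣ ≤ E * y →
    ∀ n → q * ∣ x ^ n - y ^ n ∣ ≤ 3 ^ n * E * y ^ n
  ^-close q E {x} {y} x≤2y close zero    = ≤-trans (≤-reflexive (*-zeroʳ q)) z≤n
  ^-close q E {x} {y} x≤2y close (suc n) = begin
      q * ∣ x * x ^ n - y * y ^ n ∣
        ≤⟨ *-monoʳ-≤ q (∣-∣-triangle (x * x ^ n) (x * y ^ n) (y * y ^ n)) ⟩
      q * (∣ x * x ^ n - x * y ^ n ∣ + ∣ x * y ^ n - y * y ^ n ∣)
        ≡⟨ cong₂ (λ a b → q * (a + b)) (sym (*-distribˡ-∣-∣ x (x ^ n) (y ^ n))) (sym (*-distribʳ-∣-∣ (y ^ n) x y)) ⟩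
      q * (x * ∣ x ^ n - y ^ n ∣ + ∣ x - y ∣ * y ^ n)
        ≡⟨ rearrange₁ q x ∣ x ^ n - y ^ n ∣ ∣ x - y ∣ (y ^ n) ⟩
      x * (q * ∣ x ^ n - y ^ n ∣) + q * ∣ x - y ∣ * y ^ n
        ≤⟨ +-mono-≤ (*-mono-≤ x≤2y (^-close q E x≤2y close n)) (*-monoˡ-≤ (y ^ n) close) ⟩
      2 * y * (3 ^ n * E * y ^ n) + E * y * y ^ n
        ≡⟨ cong (λ a → 2 * y * (3 ^ n * E * y ^ n) + a) (sym (*-identityˡ (E * y * y ^ n))) ⟩
      2 * y * (3 ^ n * E * y ^ n) + 1 * (E * y * y ^ n)
        ≤⟨ +-monoʳ-≤ (2 * y * (3 ^ n * E * y ^ n)) (*-monoˡ-≤ (E * y * y ^ n) (m^n>0 3 n)) ⟩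
      2 * y * (3 ^ n * E * y ^ n) + 3 ^ n * (E * y * y ^ n)
        ≡⟨ rearrange₂ y (3 ^ n) E (y ^ n) ⟩
      3 * 3 ^ n * E * (y * y ^ n) ∎
    where
    open ≤-Reasoning
    rearrange₁ : ∀ q x d e p → q * (x * d + e * p) ≡ x * (q * d) + q * e * p
    rearrange₁ = solve-∀
    rearrange₂ : ∀ y t E p → 2 * y * (t * E * p) + t * (E * y * p) ≡ 3 * t * E * (y * p)
    rearrange₂ = solve-∀

  module _ {q : ℕ} (3≤q : 3 ≤ q) where

    private
      instance
        q≢0 : NonZero q
        q≢0 = >-nonZero (≤-trans (s≤s z≤n) 3≤q)

      q^q : q ^ q ≡ q * q ^ pred q
      q^q = cong (q ^_) (sym (suc-pred q))

      N = length (nonconstants q)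
      c₁ = pred (q ^ pred q)

      suc-c₁ : suc c₁ ≡ q ^ pred q
      suc-c₁ = suc-pred (q ^ pred q) {{m^n≢0 q (pred q)}}

      count-1 : ∀ {x y : Vec (Fin q) 1} → ∑ (nonconstants q) (λ g → χ (Vec.map (lookup g) x ≟ᵛ y)) ≡ c₁
      count-1 {a ∷ []} {b ∷ []} = suc-injective (trans (*-cancelˡ-≡ _ (q ^ pred q) q (trans (count-nonconstants-1 a b) q^q)) (sym suc-c₁))

      -- Splitting the nonconstant tables by their value at one point gives `q` classes of equal
      -- size. This makes the first moment exact, as the error bound 0 at `k = 1` demands.
      N≡q*c₁ : N ≡ q * c₁
      N≡q*c₁ = begin
          N
            ≡⟨ sym (∑-1 (nonconstants q)) ⟩
          ∑ (nonconstants q) (λ _ → 1)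
            ≡⟨ ∑-cong (nonconstants q) (λ g → sym (∑-δ _≟ᵛ_ (points-unique 1 q) (∈-points (Vec.map (lookup g) x)) (λ _ → 1))) ⟩
          ∑ (nonconstants q) (λ g → ∑ (points 1 q) (λ y → χ (Vec.map (lookup g) x ≟ᵛ y) * 1))
            ≡⟨ ∑-comm (nonconstants q) (points 1 q) _ ⟩
          ∑ (points 1 q) (λ y → ∑ (nonconstants q) (λ g → χ (Vec.map (lookup g) x ≟ᵛ y) * 1))
            ≡⟨ ∑-cong (points 1 q) (λ y → trans (∑-*ʳ (nonconstants q) 1 _) (trans (*-identityʳ _) (count-1 {x} {y}))) ⟩
          ∑ (points 1 q) (λ _ → c₁)
            ≡⟨ trans (∑-const (points 1 q) c₁) (cong (_* c₁) (trans (sym (∑-1 (points 1 q))) (∑-vectors-1 (allFin q) 1))) ⟩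
          length (allFin q) ^ 1 * c₁
            ≡⟨ cong (_* c₁) (trans (*-identityʳ _) (length-allFin q)) ⟩
          q * c₁ ∎
        where
        open ≡-Reasoning
        x = replicate 1 (Fin.fromℕ< (≤-trans (s≤s z≤n) 3≤q))

      q^q≡N+q : q ^ q ≡ N + q
      q^q≡N+q = begin
        q ^ q            ≡⟨ q^q ⟩
        q * q ^ pred q   ≡⟨ cong (q *_) (sym suc-c₁) ⟩
        q * suc c₁       ≡⟨ *-suc q c₁ ⟩
        q + q * c₁       ≡⟨ +-comm q (q * c₁) ⟩
        q * c₁ + q       ≡⟨ cong (_+ q) (sym N≡q*c₁) ⟩
        N + q            ∎
        where open ≡-Reasoning

      -- Bounds by `1 / q` the relative error of replacing `q ^ q = N + q` by `N`. It fails for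
      -- `q = 2`, where `N = 2`.
      q*q≤N : q * q ≤ N
      q*q≤N = +-cancelʳ-≤ q (q * q) N (begin
        q * q + q            ≤⟨ +-monoʳ-≤ (q * q) (m≤m*n q q) ⟩
        q * q + q * q        ≡⟨ cong (q * q +_) (sym (+-identityʳ (q * q))) ⟩
        2 * (q * q)          ≤⟨ *-monoˡ-≤ (q * q) (≤-trans (s≤s (s≤s z≤n)) 3≤q) ⟩
        q * (q * q)          ≡⟨ cong (λ m → q * (q * m)) (sym (*-identityʳ q)) ⟩
        q ^ 3                ≤⟨ ^-monoʳ-≤ q 3≤q ⟩
        q ^ q                ≡⟨ q^q≡N+q ⟩
        N + q                ∎)
        where open ≤-Reasoning

      q^q≤2N : q ^ q ≤ 2 * N
      q^q≤2N = begin
        q ^ q   ≡⟨ q^q≡N+q ⟩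
        N + q   ≤⟨ +-monoʳ-≤ N (≤-trans (m≤m*n q q) q*q≤N) ⟩
        N + N   ≡⟨ cong (N +_) (sym (+-identityʳ N)) ⟩
        2 * N   ∎
        where open ≤-Reasoning

    nonconstants-nonempty : NonZero N
    nonconstants-nonempty = >-nonZero (≤-trans (*-mono-≤ (>-nonZero⁻¹ q) (>-nonZero⁻¹ q)) q*q≤N)

    moment : ℕ → ℕ → ℕ
    moment n k = ∑ (vectors n (nonconstants q)) (λ hs → fall (fixedPoints hs) k)

    private
      -- (F / N)ⁿ is the k-th factorial moment of the number of fixed points; for k > q it vanishes.
      moment-base : ∀ n k → ∃[ F ] moment (suc n) k ≡ F ^ suc n × F ≤ 2 * N × q * ∣ F - N ∣ ≤ 2 * (k * pred k) * N
      moment-base n 0 = 1 * N , factorialMoment (nonconstants q) 0 N (λ { {[]} {[]} _ _ → ∑-1 (nonconstants q) }) n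
        , *-monoˡ-≤ N {1} {2} (s≤s z≤n)
        , ≤-reflexive (trans (cong (q *_) (m≡n⇒∣m-n∣≡0 (*-identityˡ N))) (*-zeroʳ q))
      moment-base n 1 = q * 1 * c₁ , factorialMoment (nonconstants q) 1 c₁ (λ {x} {y} _ _ → count-1 {x} {y}) n
        , ≤-trans (≤-reflexive eq) (m≤m+n N (N + 0))
        , ≤-reflexive (trans (cong (q *_) (m≡n⇒∣m-n∣≡0 eq)) (*-zeroʳ q))
        where
        eq : q * 1 * c₁ ≡ N
        eq = trans (cong (_* c₁) (*-identityʳ q)) (sym N≡q*c₁)
      moment-base n k@(suc (suc j)) with k ≤? q
      ... | no k≰q = 0
        , trans (∑-cong (vectors (suc n) (nonconstants q)) (λ hs →
            fall-zero (fixedPoints hs) (≤-<-trans (fixedPoints≤q hs) q<k)))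
          (∑-0 (vectors (suc n) (nonconstants q)))
        -- With `F = 0` the distance to `N` is all of `N`; the bound allows it because `q ≤ k - 1`.
        , z≤n , *-monoˡ-≤ N (begin
            q                ≤⟨ ≤-pred q<k ⟩
            suc j            ≤⟨ m≤n*m (suc j) k ⟩
            k * suc j        ≤⟨ m≤n*m (k * suc j) 2 ⟩
            2 * (k * suc j)  ∎)
        where
        open ≤-Reasoning
        q<k = ≰⇒> k≰q
      ... | yes k≤q = F
        , factorialMoment (nonconstants q) k c
            (λ x! y! → *-cancelˡ-≡ _ c (q ^ k) {{m^n≢0 q k}} (trans (count-nonconstants≥2 x! y!) (sym q^k*c)))
            n
        , ≤-trans F≤q^q q^q≤2N
        , ≤-trans (≤-reflexive (*-distribˡ-∣-∣ q F N)) (∣-∣≤ upper lower)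
        where
        open ≤-Reasoning
        c = q ^ (q ∸ k)
        F = fall q k * c
        q^k*c : q ^ k * c ≡ q ^ q
        q^k*c = trans (sym (^-distribˡ-+-* q k (q ∸ k))) (cong (q ^_) (m+[n∸m]≡n k≤q))
        F≤q^q : F ≤ q ^ q
        F≤q^q = ≤-trans (*-monoˡ-≤ c (fall≤^ q k)) (≤-reflexive q^k*c)
        upper : q * F ≤ q * N + 2 * (k * suc j) * N
        upper = begin
          q * F                          ≤⟨ *-monoʳ-≤ q (≤-trans F≤q^q (≤-reflexive q^q≡N+q)) ⟩
          q * (N + q)                    ≡⟨ *-distribˡ-+ q N q ⟩
          q * N + q * q                  ≤⟨ +-monoʳ-≤ (q * N) q*q≤N ⟩
          q * N + N                      ≤⟨ +-monoʳ-≤ (q * N) (m≤n*m N (2 * (k * suc j))) ⟩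
          q * N + 2 * (k * suc j) * N    ∎
        -- The loss in `^≤fall` is measured in units of `q ^ q`; passing to `N` by `q ^ q ≤ 2 * N`
        -- produces the factor 2 of the error.
        lower : q * N ≤ q * F + 2 * (k * suc j) * N
        lower = begin
          q * N                                        ≤⟨ *-monoʳ-≤ q (≤-trans (m≤m+n N q) (≤-reflexive (sym q^q≡N+q))) ⟩
          q * q ^ q                                    ≡⟨ cong (q *_) (sym q^k*c) ⟩
          q * (q ^ k * c)                              ≡⟨ sym (*-assoc q (q ^ k) c) ⟩
          q * q ^ k * c                                ≤⟨ *-monoˡ-≤ c (^≤fall q k) ⟩
          (q * fall q k + k * suc j * q ^ k) * c       ≡⟨ rearrange q (fall q k) (k * suc j) (q ^ k) c ⟩
          q * F + k * suc j * (q ^ k * c)              ≡⟨ cong (λ m → q * F + k * suc j * m) q^k*c ⟩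
          q * F + k * suc j * q ^ q                    ≤⟨ +-monoʳ-≤ (q * F) (*-monoʳ-≤ (k * suc j) q^q≤2N) ⟩
          q * F + k * suc j * (2 * N)                  ≡⟨ cong (q * F +_) (rearrange′ (k * suc j) N) ⟩
          q * F + 2 * (k * suc j) * N                  ∎
          where
          rearrange : ∀ q f w p c → (q * f + w * p) * c ≡ q * (f * c) + w * (p * c)
          rearrange = solve-∀
          rearrange′ : ∀ w N → w * (2 * N) ≡ 2 * w * N
          rearrange′ = solve-∀

    moment-close : ∀ n k →
      q * ∣ moment (suc n) k - N ^ suc n ∣ ≤ 3 ^ suc n * (2 * (k * pred k)) * N ^ suc n
    moment-close n k with moment-base n k
    ... | F , eq , F≤2N , close = subst (λ m → q * ∣ m - N ^ suc n ∣ ≤ 3 ^ suc n * (2 * (k * pred k)) * N ^ suc n)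
      (sym eq) (^-close q (2 * (k * pred k)) F≤2N close (suc n))

open Moments

-- Alternating series for indicators and the partial sums for e⁻¹.

module ExponentialSeries where

  open import Defs using (expTerm; expSum; ratio)
  open import Data.Integer as ℤ using (+_; -[1+_])
  import Data.Integer.Properties as ℤ
  open import Data.Nat as ℕ using (ℕ; zero; suc; pred; z≤n; s≤s; _!; _∸_)
  import Data.Nat.Properties as ℕ
  import Data.Nat.Tactic.RingSolver as ℕ-Ring
  open import Data.Rational
  open import Data.Rational.Properties
  open import Data.Rational.Solver using (module +-*-Solver)
  import Data.Rational.Unnormalised as ℚᵘ
  import Data.Rational.Unnormalised.Properties as ℚᵘ
  open import Algebra.Definitions.RawSemiring +-*-rawSemiring using (_^_)
  open +-*-Solver using (solve; _:+_; _:*_; _:-_; :-_; con; _:=_)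

  toℚᵘ-/ : ∀ z d → toℚᵘ (z / suc d) ℚᵘ.≃ ℚᵘ.mkℚᵘ z d
  toℚᵘ-/ z d = toℚᵘ-fromℚᵘ (ℚᵘ.mkℚᵘ z d)

  opaque
    ι : ℕ → ℚ
    ι k = + k / 1

    toℚᵘ-ι : ∀ k → toℚᵘ (ι k) ℚᵘ.≃ ℚᵘ.mkℚᵘ (+ k) 0
    toℚᵘ-ι k = toℚᵘ-/ (+ k) 0

    ι-0 : ι 0 ≡ 0ℚ
    ι-0 = refl

    ι-1 : ι 1 ≡ 1ℚ
    ι-1 = refl

    instance
      ι-nonNeg : ∀ {k} → NonNegative (ι k)
      ι-nonNeg {k} = normalize-nonNeg k 1

      ι-pos : ∀ {k} .{{_ : ℕ.NonZero k}} → Positive (ι k)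
      ι-pos {k} = normalize-pos k 1

  ι-+ : ∀ a b → ι (a ℕ.+ b) ≡ ι a + ι b
  ι-+ a b = toℚᵘ-injective (ℚᵘ.≃-trans (toℚᵘ-ι (a ℕ.+ b)) (ℚᵘ.≃-sym (ℚᵘ.≃-trans
    (toℚᵘ-homo-+ (ι a) (ι b)) (ℚᵘ.≃-trans (ℚᵘ.+-cong (toℚᵘ-ι a) (toℚᵘ-ι b))
    (ℚᵘ.*≡* (cong (ℤ._* + 1) (cong₂ ℤ._+_ (ℤ.*-identityʳ (+ a)) (ℤ.*-identityʳ (+ b)))))))))

  ratio-* : ∀ a b d → ratio a (suc d) * ι b ≡ ratio (a ℕ.* b) (suc d)
  ratio-* a b d = toℚᵘ-injective (ℚᵘ.≃-trans (toℚᵘ-homo-* (ratio a (suc d)) (ι b))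
    (ℚᵘ.≃-trans (ℚᵘ.*-cong (toℚᵘ-/ (+ a) d) (toℚᵘ-ι b))
    (ℚᵘ.≃-trans (ℚᵘ.*≡* (cong₂ ℤ._*_ (sym (ℤ.pos-* a b)) (cong (+_ ∘ suc) (sym (ℕ.*-identityʳ d)))))
    (ℚᵘ.≃-sym (toℚᵘ-/ (+ (a ℕ.* b)) d)))))

  ι-* : ∀ a b → ι (a ℕ.* b) ≡ ι a * ι b
  ι-* a b = toℚᵘ-injective (ℚᵘ.≃-trans (toℚᵘ-ι (a ℕ.* b)) (ℚᵘ.≃-sym (ℚᵘ.≃-trans
    (toℚᵘ-homo-* (ι a) (ι b)) (ℚᵘ.≃-trans (ℚᵘ.*-cong (toℚᵘ-ι a) (toℚᵘ-ι b))
    (ℚᵘ.*≡* (cong (ℤ._* + 1) (sym (ℤ.pos-* a b))))))))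

  ratio-cancel : ∀ a d .{{_ : ℕ.NonZero d}} → ratio a d * ι d ≡ ι a
  ratio-cancel a (suc d) = trans (ratio-* a (suc d) d) (toℚᵘ-injective (ℚᵘ.≃-trans (toℚᵘ-/ (+ (a ℕ.* suc d)) d)
    (ℚᵘ.≃-trans (ℚᵘ.*≡* (trans (ℤ.*-identityʳ _) (ℤ.pos-* a (suc d)))) (ℚᵘ.≃-sym (toℚᵘ-ι a)))))

  ι-mono-≤ : ∀ {a b} → a ℕ.≤ b → ι a ≤ ι b
  ι-mono-≤ {a} {b} a≤b = begin
      ι a                  ≡⟨ sym (+-identityʳ (ι a)) ⟩
      ι a + 0ℚ             ≤⟨ +-monoʳ-≤ (ι a) (nonNegative⁻¹ (ι (b ∸ a))) ⟩
      ι a + ι (b ∸ a)      ≡⟨ sym (ι-+ a (b ∸ a)) ⟩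
      ι (a ℕ.+ (b ∸ a))    ≡⟨ cong ι (ℕ.m+[n∸m]≡n a≤b) ⟩
      ι b                  ∎
    where open ≤-Reasoning

  ι-mono-< : ∀ {a b} → a ℕ.< b → ι a < ι b
  ι-mono-< {a} {b} a<b = <-≤-trans (begin-strict
      ι a                  ≡⟨ sym (+-identityˡ (ι a)) ⟩
      0ℚ + ι a             <⟨ +-monoˡ-< (ι a) (positive⁻¹ (ι 1)) ⟩
      ι 1 + ι a            ≡⟨ sym (ι-+ 1 a) ⟩
      ι (suc a)            ∎) (ι-mono-≤ a<b)
    where open ≤-Reasoning

  ∣ι-ι∣ : ∀ a b → ∣ ι a - ι b ∣ ≡ ι ℕ.∣ a - b ∣
  ∣ι-ι∣ a b with ℕ.≤-total a b
  ... | inj₁ a≤b = begin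
      ∣ ι a - ι b ∣                  ≡⟨ cong (λ m → ∣ ι a - ι m ∣) (sym (ℕ.m+[n∸m]≡n a≤b)) ⟩
      ∣ ι a - ι (a ℕ.+ (b ∸ a)) ∣    ≡⟨ cong (λ x → ∣ ι a - x ∣) (ι-+ a (b ∸ a)) ⟩
      ∣ ι a - (ι a + ι (b ∸ a)) ∣    ≡⟨ cong ∣_∣ (solve 2 (λ x y → x :- (x :+ y) := :- y) refl (ι a) (ι (b ∸ a))) ⟩
      ∣ - ι (b ∸ a) ∣                ≡⟨ trans (∣-p∣≡∣p∣ _) (0≤p⇒∣p∣≡p (nonNegative⁻¹ (ι (b ∸ a)))) ⟩
      ι (b ∸ a)                      ≡⟨ cong ι (sym (ℕ.m≤n⇒∣m-n∣≡n∸m a≤b)) ⟩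
      ι ℕ.∣ a - b ∣                  ∎
    where open ≡-Reasoning
  ... | inj₂ b≤a = begin
      ∣ ι a - ι b ∣                  ≡⟨ cong (λ m → ∣ ι m - ι b ∣) (sym (ℕ.m+[n∸m]≡n b≤a)) ⟩
      ∣ ι (b ℕ.+ (a ∸ b)) - ι b ∣    ≡⟨ cong (λ x → ∣ x - ι b ∣) (ι-+ b (a ∸ b)) ⟩
      ∣ ι b + ι (a ∸ b) - ι b ∣      ≡⟨ cong ∣_∣ (solve 2 (λ x y → x :+ y :- x := y) refl (ι b) (ι (a ∸ b))) ⟩
      ∣ ι (a ∸ b) ∣                  ≡⟨ 0≤p⇒∣p∣≡p (nonNegative⁻¹ (ι (a ∸ b))) ⟩
      ι (a ∸ b)                      ≡⟨ cong ι (sym (ℕ.m≤n⇒∣n-m∣≡n∸m b≤a)) ⟩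
      ι ℕ.∣ a - b ∣                  ∎
    where open ≡-Reasoning

  positive⇒ratio : ∀ {ε} → 0ℚ < ε → ∃[ a ] ∃[ d ] ε ≡ ratio (suc a) (suc d)
  positive⇒ratio {mkℚ -[1+ _ ] _ _}    (*<* ())
  positive⇒ratio {mkℚ (+ zero) _ _}    (*<* (ℤ.+<+ ()))
  positive⇒ratio {ε@(mkℚ (+ suc a) d _)} _ = a , d , sym (↥p/↧p≡p ε)

  -- If `ε = (a + 1) / (d + 1)`, then `m > C * (d + 1)` forces `m * ε > C`. The form suits errors
  -- known to be at most `C / m`.
  archimedean : ∀ C {ε} → 0ℚ < ε → ∃[ M ] ∀ m {x} → M ℕ.≤ m → ι m * x ≤ ι C → x < ε
  archimedean C {ε} 0<ε with positive⇒ratio 0<ε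
  ... | a , d , refl = suc (C ℕ.* suc d) , λ m {x} M≤m mx≤C → ≰⇒> λ ε≤x → <-irrefl refl (begin-strict
      ι (C ℕ.* suc d)          <⟨ ι-mono-< M≤m ⟩
      ι m                      ≤⟨ ι-mono-≤ (ℕ.m≤m*n m (suc a)) ⟩
      ι (m ℕ.* suc a)          ≡⟨ ι-* m (suc a) ⟩
      ι m * ι (suc a)          ≡⟨ sym (trans (*-assoc (ι m) ε _) (cong (ι m *_) (ratio-cancel (suc a) (suc d)))) ⟩
      ι m * ε * ι (suc d)      ≤⟨ *-monoʳ-≤-nonNeg (ι (suc d)) {ι m * ε} {ι m * x} (*-monoˡ-≤-nonNeg (ι m) ε≤x) ⟩
      ι m * x * ι (suc d)      ≤⟨ *-monoʳ-≤-nonNeg (ι (suc d)) {ι m * x} {ι C} mx≤C ⟩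
      ι C * ι (suc d)          ≡⟨ sym (ι-* C (suc d)) ⟩
      ι (C ℕ.* suc d)          ∎)
    where open ≤-Reasoning

  opaque
    recip : ℕ → ℚ
    recip k = (+ 1 / (k !)) {{k ℕ.!≢0}}

    expTerm≡ : ∀ x k → expTerm x k ≡ x ^ k * recip k
    expTerm≡ x k = refl

    recip-suc : ∀ k → recip k ≡ ι (suc k) * recip (suc k)
    recip-suc k = go k (k !) {{k ℕ.!≢0}}
      where
      go : ∀ k m .{{_ : ℕ.NonZero m}} → + 1 / m ≡ ι (suc k) * (+ 1 / (suc k ℕ.* m)) {{ℕ.m*n≢0 (suc k) m}}
      go k (suc m) = toℚᵘ-injective (ℚᵘ.≃-trans (toℚᵘ-/ (+ 1) m) (ℚᵘ.≃-sym (ℚᵘ.≃-trans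
        (toℚᵘ-homo-* (ι (suc k)) (+ 1 / (suc k ℕ.* suc m)))
        (ℚᵘ.≃-trans (ℚᵘ.*-cong (toℚᵘ-ι (suc k)) (toℚᵘ-/ (+ 1) (m ℕ.+ k ℕ.* suc m)))
        (ℚᵘ.*≡* (cong +_ (eq k m)))))))
        where
        eq : ∀ k m → suc k ℕ.* 1 ℕ.* suc m ≡ 1 ℕ.* (1 ℕ.* (suc k ℕ.* suc m))
        eq = ℕ-Ring.solve-∀

    recip-1 : recip 1 ≡ 1ℚ
    recip-1 = refl

    instance
      recip-nonNeg : ∀ {k} → NonNegative (recip k)
      recip-nonNeg {k} = normalize-nonNeg 1 (k !) {{k ℕ.!≢0}}

  p≤∣p∣ : ∀ p → p ≤ ∣ p ∣
  p≤∣p∣ p with ≤-total 0ℚ p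
  ... | inj₁ 0≤p = ≤-reflexive (sym (0≤p⇒∣p∣≡p 0≤p))
  ... | inj₂ p≤0 = ≤-trans p≤0 (0≤∣p∣ p)

  term : ℕ → ℚ
  term = expTerm (- 1ℚ)

  -- Expressing a term by its successor avoids division; the sign and the factor `k + 1` are what
  -- cancels against Pascal's rule in `alternating-suc`.
  term-suc : ∀ k → term k ≡ - (ι (suc k) * term (suc k))
  term-suc k = begin
      term k                                       ≡⟨ trans (expTerm≡ (- 1ℚ) k) (cong (p *_) (recip-suc k)) ⟩
      p * (n * r)                                  ≡⟨ solve 3 (λ p n r → p :* (n :* r) := :- (n :* ((:- con 1ℚ) :* p :* r))) refl p n r ⟩
      - (n * (- 1ℚ * p * r))                       ≡⟨ cong (λ x → - (n * x)) (sym (expTerm≡ (- 1ℚ) (suc k))) ⟩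
      - (n * term (suc k))                         ∎
    where
    open ≡-Reasoning
    p = (- 1ℚ) ^ k
    n = ι (suc k)
    r = recip (suc k)

  ∣term∣ : ∀ k → ∣ term k ∣ ≡ recip k
  ∣term∣ zero    = sym (trans (recip-suc 0) (trans (cong₂ _*_ ι-1 recip-1) refl))
  ∣term∣ (suc k) = *-cancelˡ-ι (suc k) (begin
      ι (suc k) * ∣ term (suc k) ∣     ≡⟨ cong (_* ∣ term (suc k) ∣) (sym (0≤p⇒∣p∣≡p (nonNegative⁻¹ (ι (suc k))))) ⟩
      ∣ ι (suc k) ∣ * ∣ term (suc k) ∣ ≡⟨ sym (∣p*q∣≡∣p∣*∣q∣ (ι (suc k)) (term (suc k))) ⟩
      ∣ ι (suc k) * term (suc k) ∣     ≡⟨ sym (∣-p∣≡∣p∣ (ι (suc k) * term (suc k))) ⟩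
      ∣ - (ι (suc k) * term (suc k)) ∣ ≡⟨ cong ∣_∣ (sym (term-suc k)) ⟩
      ∣ term k ∣                       ≡⟨ trans (∣term∣ k) (recip-suc k) ⟩
      ι (suc k) * recip (suc k)        ∎)
    where
    open ≡-Reasoning
    *-cancelˡ-ι : ∀ m .{{_ : ℕ.NonZero m}} {x y} → ι m * x ≡ ι m * y → x ≡ y
    *-cancelˡ-ι m eq = ≤-antisym (*-cancelˡ-≤-pos (ι m) (≤-reflexive eq)) (*-cancelˡ-≤-pos (ι m) (≤-reflexive (sym eq)))

  sumTo : ℕ → (ℕ → ℚ) → ℚ
  sumTo zero    f = 0ℚ
  sumTo (suc K) f = sumTo K f + f K

  sumTo-cong : ∀ K {f g : ℕ → ℚ} → (∀ k → f k ≡ g k) → sumTo K f ≡ sumTo K g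
  sumTo-cong zero    eq = refl
  sumTo-cong (suc K) eq = cong₂ _+_ (sumTo-cong K eq) (eq K)

  sumTo-*ˡ : ∀ K c (f : ℕ → ℚ) → sumTo K (λ k → c * f k) ≡ c * sumTo K f
  sumTo-*ˡ zero    c f = sym (*-zeroʳ c)
  sumTo-*ˡ (suc K) c f = trans (cong (_+ c * f K) (sumTo-*ˡ K c f)) (sym (*-distribˡ-+ c (sumTo K f) (f K)))

  -- Pascal's rule telescopes: ∑ (-1)ᵏ C(m+1, k) over k ≤ K is (-1)ᴷ C(m, K).
  alternating-suc : ∀ m K → sumTo (suc K) (λ k → term k * ι (fall (suc m) k)) ≡ term K * ι (fall m K)
  alternating-suc m zero    = +-identityˡ (term 0 * ι 1)
  alternating-suc m (suc K) = begin
      sumTo (suc K) (λ k → term k * ι (fall (suc m) k)) + t′ * ι (suc m ℕ.* f)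
        ≡⟨ cong₂ _+_ (trans (alternating-suc m K) (cong (_* ι f) (term-suc K)))
                     (cong (t′ *_) (trans (cong ι pascal) (trans (ι-+ (f ℕ.* suc K) f′) (cong (_+ ι f′) (ι-* f (suc K)))))) ⟩
      - (ι (suc K) * t′) * ι f + t′ * (ι f * ι (suc K) + ι f′)
        ≡⟨ solve 4 (λ s t a b → :- (s :* t) :* a :+ t :* (a :* s :+ b) := t :* b) refl (ι (suc K)) t′ (ι f) (ι f′) ⟩
      t′ * ι f′ ∎
    where
    open ≡-Reasoning
    t′ = term (suc K)
    f  = fall m K
    f′ = fall m (suc K)
    pascal : suc m ℕ.* f ≡ f ℕ.* suc K ℕ.+ f′
    pascal with K ℕ.≤? m
    ... | yes K≤m = begin
      suc m ℕ.* f                      ≡⟨ ℕ.*-comm (suc m) f ⟩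
      f ℕ.* suc m                      ≡⟨ cong (λ j → f ℕ.* suc j) (sym (ℕ.m+[n∸m]≡n K≤m)) ⟩
      f ℕ.* (suc K ℕ.+ (m ∸ K))        ≡⟨ ℕ.*-distribˡ-+ f (suc K) (m ∸ K) ⟩
      f ℕ.* suc K ℕ.+ f ℕ.* (m ∸ K)    ≡⟨ cong (f ℕ.* suc K ℕ.+_) (sym (fall-sucʳ m K)) ⟩
      f ℕ.* suc K ℕ.+ f′               ∎
    ... | no K≰m rewrite fall-zero m (ℕ.≰⇒> K≰m) | fall-zero m (ℕ.m<n⇒m<1+n (ℕ.≰⇒> K≰m)) = ℕ.*-zeroʳ m

  -- For positive `m` the closed form of the partial sum contains a falling factorial that vanishes
  -- from this length on. Every longer cut is equally exact, so `K` stays free.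
  alternating-0 : ∀ m {K} → m ℕ.< K → ι (χ (m ℕ.≟ 0)) ≡ sumTo K (λ k → term k * ι (fall m k))
  alternating-0 zero    {suc K} _ = sym (go K)
    where
    go : ∀ K → sumTo (suc K) (λ k → term k * ι (fall 0 k)) ≡ ι 1
    go zero    = trans (+-identityˡ (term 0 * ι 1)) (*-identityˡ (ι 1))
    go (suc K) = trans (cong₂ _+_ (go K) (trans (cong (term (suc K) *_) ι-0) (*-zeroʳ (term (suc K))))) (+-identityʳ (ι 1))
  alternating-0 (suc m) {suc K} (s≤s m<K) = sym (trans (alternating-suc m K)
    (trans (cong (λ j → term K * ι j) (fall-zero m m<K)) (trans (cong (term K *_) ι-0) (trans (*-zeroʳ (term K)) (sym ι-0)))))

  -- Pulling out the factor `m` of `fall m (suc k)` leaves the previous series at `pred m`, and `m`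
  -- times the indicator of `pred m = 0` is the indicator of `m = 1`, also for `m = 0`.
  alternating-1 : ∀ m {K} → m ℕ.< K → ι (χ (m ℕ.≟ 1)) ≡ sumTo K (λ k → term k * ι (fall m (suc k)))
  alternating-1 m {K} m<K = sym (begin
      sumTo K (λ k → term k * ι (m ℕ.* fall (pred m) k))
        ≡⟨ sumTo-cong K (λ k → trans (cong (term k *_) (ι-* m _))
             (solve 3 (λ t a b → t :* (a :* b) := a :* (t :* b)) refl (term k) (ι m) (ι (fall (pred m) k)))) ⟩
      sumTo K (λ k → ι m * (term k * ι (fall (pred m) k)))
        ≡⟨ sumTo-*ˡ K (ι m) _ ⟩
      ι m * sumTo K (λ k → term k * ι (fall (pred m) k))
        ≡⟨ cong (ι m *_) (sym (alternating-0 (pred m) (ℕ.≤-<-trans ℕ.pred[n]≤n m<K))) ⟩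
      ι m * ι (χ (pred m ℕ.≟ 0))
        ≡⟨ sym (ι-* m _) ⟩
      ι (m ℕ.* χ (pred m ℕ.≟ 0))
        ≡⟨ cong ι (indicator m) ⟩
      ι (χ (m ℕ.≟ 1)) ∎)
    where
    open ≡-Reasoning
    indicator : ∀ m → m ℕ.* χ (pred m ℕ.≟ 0) ≡ χ (m ℕ.≟ 1)
    indicator 0             = refl
    indicator 1             = refl
    indicator (suc (suc m)) = ℕ.*-zeroʳ m

  -- Linearity of expectation: indicators turn into counts and falling factorials into factorial
  -- moments.
  ∑-sumTo : {A : Set} (xs : List A) (K : ℕ) {φ : A → ℕ} {ψ : A → ℕ → ℕ} →
    (∀ x → ι (φ x) ≡ sumTo K (λ k → term k * ι (ψ x k))) →
    ι (∑ xs φ) ≡ sumTo K (λ k → term k * ι (∑ xs (λ x → ψ x k)))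
  ∑-sumTo []       K eq = sym (trans (sumTo-cong K (λ k → *-comm (term k) (ι 0))) (trans (sumTo-*ˡ K (ι 0) term)
    (trans (cong (_* sumTo K term) ι-0) (trans (*-zeroˡ (sumTo K term)) (sym ι-0)))))
  ∑-sumTo (x ∷ xs) K {φ} {ψ} eq = trans (ι-+ (φ x) (∑ xs φ))
    (trans (cong₂ _+_ (eq x) (∑-sumTo xs K eq)) (merge K))
    where
    merge : ∀ K → sumTo K (λ k → term k * ι (ψ x k)) + sumTo K (λ k → term k * ι (∑ xs (λ y → ψ y k)))
                ≡ sumTo K (λ k → term k * ι (∑ (x ∷ xs) (λ y → ψ y k)))
    merge zero    = refl
    merge (suc K) = trans
      (solve 5 (λ a b t u v → (a :+ t :* u) :+ (b :+ t :* v) := (a :+ b) :+ t :* (u :+ v)) refl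
        (sumTo K (λ k → term k * ι (ψ x k))) (sumTo K (λ k → term k * ι (∑ xs (λ y → ψ y k))))
        (term K) (ι (ψ x K)) (ι (∑ xs (λ y → ψ y K))))
      (cong₂ _+_ (merge K) (cong (term K *_) (sym (ι-+ (ψ x K) _))))

  -- Partial sums of a series with value 3e, hence the bound 9 below. The weight is `k * suc k`
  -- because the series for exactly one fixed point pairs `term k` with the moment of order `k + 1`.
  weights : ℕ → ℚ
  weights K = sumTo K (λ k → recip k * ι (k ℕ.* suc k))

  -- The polynomial k² + 2k + 6 is chosen to make the left-hand side decrease with k.
  weights≤9 : ∀ K → weights (suc K) + recip (suc K) * ι (suc K ℕ.* suc K ℕ.+ 2 ℕ.* suc K ℕ.+ 6) ≤ ι 9
  -- The induction starts at index 1, where the polynomial is 9; the slack `3 * (k - 1)` of the step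
  -- from `k` would be negative at `k = 0`.
  weights≤9 zero    = ≤-reflexive (begin
      (0ℚ + recip 0 * ι 0) + recip 1 * ι 9  ≡⟨ cong₂ (λ a b → (0ℚ + recip 0 * a) + b * ι 9) ι-0 recip-1 ⟩
      (0ℚ + recip 0 * 0ℚ) + 1ℚ * ι 9        ≡⟨ solve 2 (λ r n → (con 0ℚ :+ r :* con 0ℚ) :+ con 1ℚ :* n := n) refl
                                                 (recip 0) (ι 9) ⟩
      ι 9                                   ∎)
    where open ≡-Reasoning
  weights≤9 (suc j) = begin
      (w + recip k * ι (k ℕ.* suc k)) + r * ι (c (suc k))
        ≡⟨ cong (λ x → (w + x * ι (k ℕ.* suc k)) + r * ι (c (suc k))) (recip-suc k) ⟩
      (w + ι (suc k) * r * ι (k ℕ.* suc k)) + r * ι (c (suc k))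
        ≡⟨ solve 5 (λ w n r a b → (w :+ n :* r :* a) :+ r :* b := w :+ r :* (n :* a :+ b)) refl
             w (ι (suc k)) r (ι (k ℕ.* suc k)) (ι (c (suc k))) ⟩
      w + r * (ι (suc k) * ι (k ℕ.* suc k) + ι (c (suc k)))
        ≡⟨ cong (λ x → w + r * x) (sym (trans (ι-+ (suc k ℕ.* (k ℕ.* suc k)) (c (suc k)))
             (cong (λ x → x + ι (c (suc k))) (ι-* (suc k) (k ℕ.* suc k))))) ⟩
      w + r * ι (suc k ℕ.* (k ℕ.* suc k) ℕ.+ c (suc k))
        -- With everything over `(k + 1)!`, the two sides differ by exactly `3 * j`.
        ≤⟨ +-monoʳ-≤ w (*-monoˡ-≤-nonNeg r (ι-mono-≤ (ℕ.≤-trans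
             (ℕ.m≤m+n (suc k ℕ.* (k ℕ.* suc k) ℕ.+ c (suc k)) (3 ℕ.* j)) (ℕ.≤-reflexive (poly j))))) ⟩
      w + r * ι (suc k ℕ.* c k)
        ≡⟨ cong (λ x → w + r * x) (ι-* (suc k) (c k)) ⟩
      w + r * (ι (suc k) * ι (c k))
        ≡⟨ cong (λ x → w + x) (solve 3 (λ r n a → r :* (n :* a) := n :* r :* a) refl r (ι (suc k)) (ι (c k))) ⟩
      w + ι (suc k) * r * ι (c k)
        ≡⟨ cong (λ x → w + x * ι (c k)) (sym (recip-suc k)) ⟩
      w + recip k * ι (c k)
        ≤⟨ weights≤9 j ⟩
      ι 9 ∎
    where
    open ≤-Reasoning
    k = suc j
    w = weights k
    r = recip (suc k)
    c : ℕ → ℕ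
    c m = m ℕ.* m ℕ.+ 2 ℕ.* m ℕ.+ 6
    poly : ∀ j → suc (suc j) ℕ.* (suc j ℕ.* suc (suc j)) ℕ.+ (suc (suc j) ℕ.* suc (suc j) ℕ.+ 2 ℕ.* suc (suc j) ℕ.+ 6) ℕ.+ 3 ℕ.* j
               ≡ suc (suc j) ℕ.* (suc j ℕ.* suc j ℕ.+ 2 ℕ.* suc j ℕ.+ 6)
    poly = ℕ-Ring.solve-∀

  module _ (q T C : ℕ) (A : ℕ → ℕ) (A-close : ∀ k → q ℕ.* ℕ.∣ A k - T ∣ ℕ.≤ C ℕ.* (k ℕ.* suc k) ℕ.* T) where

    private
      -- Both sums have the same coefficients, so index `k` contributes at most `∣ A k - T ∣`
      -- divided by `k !`.
      weighted : ∀ K → ι q * ∣ sumTo K (λ k → term k * ι (A k)) - ι T * expSum (- 1ℚ) K ∣ ≤ ι (C ℕ.* T) * weights K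
      weighted zero = ≤-reflexive (trans (cong (λ x → ι q * ∣ 0ℚ - x ∣) (*-zeroʳ (ι T)))
        (trans (*-zeroʳ (ι q)) (sym (*-zeroʳ (ι (C ℕ.* T))))))
      weighted (suc K) = begin
          ι q * ∣ (a + t * ι (A K)) - ι T * (e + t) ∣
            ≡⟨ cong (λ x → ι q * ∣ x ∣) (solve 5
                 (λ a t y n e → (a :+ t :* y) :- n :* (e :+ t) := (a :- n :* e) :+ t :* (y :- n)) refl
                 a t (ι (A K)) (ι T) e) ⟩
          ι q * ∣ (a - ι T * e) + t * (ι (A K) - ι T) ∣
            ≤⟨ *-monoˡ-≤-nonNeg (ι q) (∣p+q∣≤∣p∣+∣q∣ (a - ι T * e) _) ⟩
          ι q * (∣ a - ι T * e ∣ + ∣ t * (ι (A K) - ι T) ∣)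
            ≡⟨ cong (λ x → ι q * (∣ a - ι T * e ∣ + x)) 
                 (trans (∣p*q∣≡∣p∣*∣q∣ t _) (cong₂ _*_ (∣term∣ K) (∣ι-ι∣ (A K) T))) ⟩
          ι q * (∣ a - ι T * e ∣ + r * ι D)
            ≡⟨ solve 4 (λ q x r d → q :* (x :+ r :* d) := q :* x :+ r :* (q :* d)) refl (ι q) ∣ a - ι T * e ∣ r (ι D) ⟩
          ι q * ∣ a - ι T * e ∣ + r * (ι q * ι D)
            ≡⟨ cong (λ x → ι q * ∣ a - ι T * e ∣ + r * x) (sym (ι-* q D)) ⟩
          ι q * ∣ a - ι T * e ∣ + r * ι (q ℕ.* D)
            ≤⟨ +-mono-≤ (weighted K) (*-monoˡ-≤-nonNeg r (ι-mono-≤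
                 (ℕ.≤-trans (A-close K) (ℕ.≤-reflexive (rearrange C (K ℕ.* suc K) T))))) ⟩
          ι (C ℕ.* T) * weights K + r * ι (C ℕ.* T ℕ.* (K ℕ.* suc K))
            ≡⟨ cong (λ x → ι (C ℕ.* T) * weights K + r * x) (ι-* (C ℕ.* T) (K ℕ.* suc K)) ⟩
          ι (C ℕ.* T) * weights K + r * (ι (C ℕ.* T) * ι (K ℕ.* suc K))
            ≡⟨ solve 4 (λ c w r k → c :* w :+ r :* (c :* k) := c :* (w :+ r :* k)) refl (ι (C ℕ.* T)) (weights K) r (ι (K ℕ.* suc K)) ⟩
          ι (C ℕ.* T) * (weights K + r * ι (K ℕ.* suc K)) ∎
        where
        open ≤-Reasoning
        a = sumTo K (λ k → term k * ι (A k))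
        e = expSum (- 1ℚ) K
        t = term K
        r = recip K
        D = ℕ.∣ A K - T ∣
        rearrange : ∀ C k T → C ℕ.* k ℕ.* T ≡ C ℕ.* T ℕ.* k
        rearrange = ℕ-Ring.solve-∀

    -- The bound does not depend on `K`, so it can be used along the whole sequence representing
    -- e⁻¹.
    ratio-close : .{{_ : ℕ.NonZero T}} → ∀ Z K → ι Z ≡ sumTo (suc K) (λ k → term k * ι (A k)) →
      ι q * ∣ ratio Z T - expSum (- 1ℚ) (suc K) ∣ ≤ ι (C ℕ.* 9)
    ratio-close Z K eq = *-cancelˡ-≤-pos (ι T) (begin
        ι T * (ι q * ∣ ratio Z T - e ∣)
          ≡⟨ solve 3 (λ T q x → T :* (q :* x) := q :* (T :* x)) refl (ι T) (ι q) ∣ ratio Z T - e ∣ ⟩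
        ι q * (ι T * ∣ ratio Z T - e ∣)
          ≡⟨ cong (λ x → ι q * (x * ∣ ratio Z T - e ∣)) (sym (0≤p⇒∣p∣≡p (nonNegative⁻¹ (ι T)))) ⟩
        ι q * (∣ ι T ∣ * ∣ ratio Z T - e ∣)
          ≡⟨ cong (ι q *_) (sym (∣p*q∣≡∣p∣*∣q∣ (ι T) (ratio Z T - e))) ⟩
        ι q * ∣ ι T * (ratio Z T - e) ∣
          ≡⟨ cong (λ x → ι q * ∣ x ∣) (solve 3 (λ T r e → T :* (r :- e) := r :* T :- T :* e) refl (ι T) (ratio Z T) e) ⟩
        ι q * ∣ ratio Z T * ι T - ι T * e ∣
          ≡⟨ cong (λ x → ι q * ∣ x - ι T * e ∣) (trans (ratio-cancel Z T) eq) ⟩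
        ι q * ∣ sumTo (suc K) (λ k → term k * ι (A k)) - ι T * e ∣
          ≤⟨ weighted (suc K) ⟩
        ι (C ℕ.* T) * weights (suc K)
          ≤⟨ *-monoˡ-≤-nonNeg (ι (C ℕ.* T)) weights≤ ⟩
        ι (C ℕ.* T) * ι 9
          ≡⟨ trans (sym (ι-* (C ℕ.* T) 9)) (trans (cong ι (rearrange C T)) (ι-* T (C ℕ.* 9))) ⟩
        ι T * ι (C ℕ.* 9) ∎)
      where
      open ≤-Reasoning
      e = expSum (- 1ℚ) (suc K)
      rearrange : ∀ C T → C ℕ.* T ℕ.* 9 ≡ T ℕ.* (C ℕ.* 9)
      rearrange = ℕ-Ring.solve-∀
      c = suc K ℕ.* suc K ℕ.+ 2 ℕ.* suc K ℕ.+ 6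
      weights≤ : weights (suc K) ≤ ι 9
      weights≤ = begin
        weights (suc K)                              ≡⟨ sym (+-identityʳ _) ⟩
        weights (suc K) + 0ℚ                         ≤⟨ +-monoʳ-≤ (weights (suc K)) (nonNegative⁻¹ (recip (suc K) * ι c)
                                                          {{nonNeg*nonNeg⇒nonNeg (recip (suc K)) (ι c)}}) ⟩
        weights (suc K) + recip (suc K) * ι c        ≤⟨ weights≤9 K ⟩
        ι 9                                          ∎

  2recip≤recip : ∀ k → recip (suc (suc k)) + recip (suc (suc k)) ≤ recip (suc k)
  2recip≤recip k = begin
      r + r                    ≡⟨ solve 1 (λ r → r :+ r := con (1ℚ + 1ℚ) :* r) refl r ⟩
      (1ℚ + 1ℚ) * r            ≡⟨ cong (_* r) (sym (trans (ι-+ 1 1) (cong₂ _+_ ι-1 ι-1))) ⟩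
      ι 2 * r                  ≤⟨ *-monoʳ-≤-nonNeg r (ι-mono-≤ (s≤s (s≤s (z≤n {k})))) ⟩
      ι (suc (suc k)) * r      ≡⟨ sym (recip-suc (suc k)) ⟩
      recip (suc k)            ∎
    where
    open ≤-Reasoning
    r = recip (suc (suc k))

  -- As 1 / k! at least halves with each step, expSum (- 1ℚ) k + 2 / k! decreases; it is 5 / 12 at k = 4.
  expSum+2recip≤ : ∀ j → expSum (- 1ℚ) (4 ℕ.+ j) + (recip (4 ℕ.+ j) + recip (4 ℕ.+ j)) ≤ + 5 / 12
  expSum+2recip≤ zero    = ≤-reflexive base
    where
    opaque
      unfolding recip
      base : expSum (- 1ℚ) 4 + (recip 4 + recip 4) ≡ + 5 / 12
      base = refl
  expSum+2recip≤ (suc j) = begin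
      (e + term k) + (recip (suc k) + recip (suc k))
        ≤⟨ +-mono-≤ (+-monoʳ-≤ e (≤-trans (p≤∣p∣ (term k)) (≤-reflexive (∣term∣ k)))) (2recip≤recip (3 ℕ.+ j)) ⟩
      (e + recip k) + recip k
        ≡⟨ +-assoc e (recip k) (recip k) ⟩
      e + (recip k + recip k)
        ≤⟨ expSum+2recip≤ j ⟩
      + 5 / 12 ∎
    where
    open ≤-Reasoning
    k = 4 ℕ.+ j
    e = expSum (- 1ℚ) k

  expSum≤ : ∀ {k} → 4 ℕ.≤ k → expSum (- 1ℚ) k ≤ + 5 / 12
  expSum≤ {k} 4≤k = subst (λ k → expSum (- 1ℚ) k ≤ + 5 / 12) (ℕ.m+[n∸m]≡n 4≤k) (begin
      e                          ≡⟨ sym (+-identityʳ e) ⟩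
      e + (0ℚ + 0ℚ)              ≤⟨ +-monoʳ-≤ e (+-mono-≤ (nonNegative⁻¹ r) (nonNegative⁻¹ r)) ⟩
      e + (r + r)                ≤⟨ expSum+2recip≤ (k ∸ 4) ⟩
      + 5 / 12                   ∎)
    where
    open ≤-Reasoning
    e = expSum (- 1ℚ) (4 ℕ.+ (k ∸ 4))
    r = recip (4 ℕ.+ (k ∸ 4))

  ratio-complement : ∀ {a b c} d .{{_ : ℕ.NonZero d}} → a ℕ.+ b ℕ.+ c ≡ d → ratio c d ≡ 1ℚ - (ratio a d + ratio b d)
  ratio-complement {a} {b} {c} d eq = *-cancelʳ-ι (begin
      ratio c d * ι d
        ≡⟨ ratio-cancel c d ⟩
      ι c
        ≡⟨ solve 3 (λ a b c → c := (a :+ b :+ c) :- (a :+ b)) refl (ι a) (ι b) (ι c) ⟩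
      (ι a + ι b + ι c) - (ι a + ι b)
        ≡⟨ cong (_- (ι a + ι b)) (sym (trans (ι-+ (a ℕ.+ b) c) (cong (_+ ι c) (ι-+ a b)))) ⟩
      ι (a ℕ.+ b ℕ.+ c) - (ι a + ι b)
        ≡⟨ cong₂ _-_ (cong ι eq) (sym (cong₂ _+_ (ratio-cancel a d) (ratio-cancel b d))) ⟩
      ι d - (ratio a d * ι d + ratio b d * ι d)
        ≡⟨ solve 3 (λ d x y → d :- (x :* d :+ y :* d) := (con 1ℚ :- (x :+ y)) :* d) refl (ι d) (ratio a d) (ratio b d) ⟩
      (1ℚ - (ratio a d + ratio b d)) * ι d ∎)
    where
    open ≡-Reasoning
    *-cancelʳ-ι : ∀ {x y} → x * ι d ≡ y * ι d → x ≡ y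
    *-cancelʳ-ι eq = ≤-antisym (*-cancelʳ-≤-pos (ι d) (≤-reflexive eq)) (*-cancelʳ-≤-pos (ι d) (≤-reflexive (sym eq)))

open ExponentialSeries

-- Maps whose interaction graph is the cycle, as tuples of tables.

module CycleMaps where

  open import Defs
  open import Data.Fin using (fromℕ; inject₁)
  open import Data.List.Extrema.Nat using (min; min≤v⁺; v≤min⁺)
  open import Data.List.Membership.Propositional.Properties using (∈-map⁺; ∈-map⁻)
  import Data.List.Relation.Unary.All as All
  import Data.List.Relation.Unary.All.Properties as All
  open import Data.List.Relation.Unary.Any as Any using (Any; here; there)
  import Data.List.Relation.Unary.Any.Properties as Any
  open import Data.List.Relation.Unary.Unique.Propositional using (Unique)
  import Data.List.Relation.Unary.Unique.Propositional.Properties as Unique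
  open import Data.Nat as ℕ using (ℕ; zero; suc; z≤n; s≤s)
  open import Data.Nat.DivMod using (_%_; n%n≡0; m<n⇒m%n≡m)
  import Data.Nat.Properties as ℕ
  open import Data.Vec using (zipWith)
  import Data.Vec.Relation.Unary.All.Properties as Allᵛ
  open import Relation.Nullary.Decidable using (decidable-stable)

  Vec-ext : {A : Set} → ∀ {n} {x y : Vec A n} → (∀ v → lookup x v ≡ lookup y v) → x ≡ y
  Vec-ext {x = x} {y} eq = trans (sym (Vec.tabulate∘lookup x)) (trans (Vec.tabulate-cong eq) (Vec.tabulate∘lookup y))

  prev : ∀ {m} → Fin (suc m) → Fin (suc m)
  prev {m} Fin.zero    = fromℕ m
  prev     (Fin.suc k) = inject₁ k

  prev-arc : ∀ {m} (v : Fin (suc m)) → Arc (C⃗ (suc m)) (prev v) v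
  prev-arc {m} Fin.zero    = trans (cong (λ j → suc j % suc m) (Fin.toℕ-fromℕ m)) (n%n≡0 (suc m))
  prev-arc {m} (Fin.suc k) = trans (cong (λ j → suc j % suc m) (Fin.toℕ-inject₁ k)) (m<n⇒m%n≡m (s≤s (Fin.toℕ<n k)))

  arc⇒prev : ∀ {m} (u v : Fin (suc m)) → Arc (C⃗ (suc m)) u v → u ≡ prev v
  arc⇒prev {m} u v arc with ℕ.m≤n⇒m<n∨m≡n (Fin.toℕ<n u)
  arc⇒prev {m} u Fin.zero    arc | inj₁ u<m = contradiction (trans (sym (m<n⇒m%n≡m u<m)) arc) λ ()
  arc⇒prev {m} u (Fin.suc k) arc | inj₁ u<m = Fin.toℕ-injective
    (trans (ℕ.suc-injective (trans (sym (m<n⇒m%n≡m u<m)) arc)) (sym (Fin.toℕ-inject₁ k)))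
  arc⇒prev {m} u Fin.zero    arc | inj₂ u≡m = Fin.toℕ-injective (trans (ℕ.suc-injective u≡m) (sym (Fin.toℕ-fromℕ m)))
  arc⇒prev {m} u (Fin.suc k) arc | inj₂ u≡m =
    contradiction (trans (sym (trans (cong (_% suc m) u≡m) (n%n≡0 (suc m)))) arc) λ ()

  -- With the last entry of the vector as first argument this is the cyclic rotation. The argument
  -- is left free so that a walk around the cycle can enter with any value.
  shift : {A : Set} → ∀ {n} → A → Vec A n → Vec A n
  shift a []      = []
  shift a (b ∷ x) = a ∷ shift b x

  lookup-shift : {A : Set} → ∀ {m} (a : A) (x : Vec A (suc m)) k → lookup (shift a x) (Fin.suc k) ≡ lookup x (inject₁ k)
  lookup-shift a (b ∷ c ∷ x) Fin.zero    = refl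
  lookup-shift a (b ∷ c ∷ x) (Fin.suc k) = lookup-shift b (c ∷ x) k

  cycleMap : ∀ {m q} → Vec (Table q) (suc m) → SelfMap (suc m) q
  cycleMap {m} hs x = zipWith lookup hs (shift (lookup x (fromℕ m)) x)

  lookup-cycleMap : ∀ {m q} (hs : Vec (Table q) (suc m)) x v →
    lookup (cycleMap hs x) v ≡ lookup (lookup hs v) (lookup x (prev v))
  lookup-cycleMap {m} hs x v = trans (Vec.lookup-zipWith lookup v hs _) (cong (lookup (lookup hs v)) (eq x v))
    where
    eq : ∀ x v → lookup (shift (lookup x (fromℕ m)) x) v ≡ lookup x (prev v)
    eq (a ∷ x) Fin.zero    = refl
    eq x       (Fin.suc k) = lookup-shift _ x k

  G-cycleMap : ∀ {m q} {f : SelfMap (suc m) q} (hs : Vec (Table q) (suc m)) → (∀ v → Nonconstant (lookup hs v)) →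
    f ≗ cycleMap hs → G f ≗ᴳ C⃗ (suc m)
  G-cycleMap {m} {q} {f} hs nc f≗ u v = mk⇔ to from
    where
    value : ∀ x → lookup (f x) v ≡ lookup (lookup hs v) (lookup x (prev v))
    value x = trans (cong (λ y → lookup y v) (f≗ x)) (lookup-cycleMap hs x v)
    to : Arc (G f) u v → Arc (C⃗ (suc m)) u v
    to (x , y , (_ , same) , fx≢fy) with prev v Fin.≟ u
    ... | yes refl = prev-arc v
    ... | no neq   = contradiction
      (trans (value x) (trans (cong (lookup (lookup hs v)) (same (prev v) neq)) (sym (value y)))) fx≢fy
    from : Arc (C⃗ (suc m)) u v → Arc (G f) u v
    from arc with nc v | arc⇒prev u v arc
    -- The table at `v` separates `a` from `b`, so changing the predecessor of `v` from `a` to `b`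
    -- witnesses the arc.
    ... | a , b , ha≢hb | refl = replicate _ a , replicate _ a [ u ]≔ b
      , ((λ eq → a≢b (trans (sym (Vec.lookup-replicate u a)) (trans eq (Vec.lookup∘update u (replicate _ a) b))))
        , λ w w≢u → sym (Vec.lookup∘update′ w≢u (replicate _ a) b))
      , λ eq → ha≢hb (begin
          lookup (lookup hs v) a
            ≡⟨ cong (lookup (lookup hs v)) (sym (Vec.lookup-replicate u a)) ⟩
          lookup (lookup hs v) (lookup (replicate _ a) u)
            ≡⟨ trans (sym (value _)) (trans eq (value _)) ⟩
          lookup (lookup hs v) (lookup (replicate _ a [ u ]≔ b) u)
            ≡⟨ cong (lookup (lookup hs v)) (Vec.lookup∘update u (replicate _ a) b) ⟩
          lookup (lookup hs v) b ∎)
      where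
      open ≡-Reasoning
      a≢b : a ≢ b
      a≢b refl = ha≢hb refl

  -- A path from `x` towards `y` changing one coordinate at a time: arcs speak only of
  -- configurations that differ in a single coordinate.
  overwrite : {A : Set} → ∀ {n} → List (Fin n) → Vec A n → Vec A n → Vec A n
  overwrite us y x = List.foldr (λ u z → z [ u ]≔ lookup y u) x us

  lookup-overwrite-∈ : {A : Set} → ∀ {n} (us : List (Fin n)) (y x : Vec A n) {w} → w ∈ us →
    lookup (overwrite us y x) w ≡ lookup y w
  lookup-overwrite-∈ (u ∷ us) y x {w} w∈ with w Fin.≟ u | w∈
  ... | yes refl | _           = Vec.lookup∘update w (overwrite us y x) _
  ... | no w≢u   | here w≡u    = contradiction w≡u w≢u
  ... | no w≢u   | there w∈us  = trans (Vec.lookup∘update′ w≢u (overwrite us y x) _) (lookup-overwrite-∈ us y x w∈us)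

  lookup-overwrite-≡ : {A : Set} → ∀ {n} (us : List (Fin n)) (y x : Vec A n) {w} → lookup x w ≡ lookup y w →
    lookup (overwrite us y x) w ≡ lookup y w
  lookup-overwrite-≡ []       y x     eq = eq
  lookup-overwrite-≡ (u ∷ us) y x {w} eq with w Fin.≟ u
  ... | yes refl = Vec.lookup∘update w (overwrite us y x) _
  ... | no w≢u   = trans (Vec.lookup∘update′ w≢u (overwrite us y x) _) (lookup-overwrite-≡ us y x eq)

  module _ {n q} (f : SelfMap n q) {p v : Fin n} (only : ∀ u → Arc (G f) u v → u ≡ p) where

    -- A change of the value at `v` would exhibit an arc from `u` to `v`; then `u` is `p`, where the
    -- update changes nothing.
    update-invariant : ∀ x u c → (u ≡ p → lookup x u ≡ c) → lookup (f (x [ u ]≔ c)) v ≡ lookup (f x) v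
    update-invariant x u c eq with lookup x u Fin.≟ c
    ... | yes refl = cong (λ y → lookup (f y) v) (Vec.[]≔-lookup x u)
    ... | no neq   = decidable-stable (lookup (f (x [ u ]≔ c)) v Fin.≟ lookup (f x) v) λ differ →
      neq (eq (only u (x [ u ]≔ c , x
        , ((λ eq′ → neq (trans (sym eq′) (Vec.lookup∘update u x c))) , λ w w≢u → Vec.lookup∘update′ w≢u x c)
        , differ)))

    overwrite-invariant : ∀ us x y → lookup x p ≡ lookup y p → lookup (f (overwrite us y x)) v ≡ lookup (f x) v
    overwrite-invariant []       x y eq = refl
    overwrite-invariant (u ∷ us) x y eq = trans
      (update-invariant (overwrite us y x) u (lookup y u) (λ { refl → lookup-overwrite-≡ us y x eq }))
      (overwrite-invariant us x y eq)

    depends-only-on : ∀ x y → lookup x p ≡ lookup y p → lookup (f x) v ≡ lookup (f y) v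
    depends-only-on x y eq = trans (sym (overwrite-invariant (allFin n) x y eq))
      (cong (λ z → lookup (f z) v) (Vec-ext (λ w → lookup-overwrite-∈ (allFin n) y x (∈-allFin w))))

  -- A constant configuration feeds `a` to every vertex, whichever its predecessor is, so all tables
  -- are read off without reference to the graph.
  tablesOf : ∀ {n q} → SelfMap n q → Vec (Table q) n
  tablesOf f = tabulate λ v → tabulate λ a → lookup (f (replicate _ a)) v

  lookup-tablesOf : ∀ {n q} (f : SelfMap n q) v a → lookup (lookup (tablesOf f) v) a ≡ lookup (f (replicate _ a)) v
  lookup-tablesOf f v a = trans (cong (λ h → lookup h a) (Vec.lookup∘tabulate _ v)) (Vec.lookup∘tabulate _ a)

  tablesOf-cong : ∀ {n q} {f g : SelfMap n q} → f ≗ g → tablesOf f ≡ tablesOf g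
  tablesOf-cong f≗g = Vec.tabulate-cong λ v → Vec.tabulate-cong λ a → cong (λ y → lookup y v) (f≗g (replicate _ a))

  tablesOf-cycleMap : ∀ {m q} (hs : Vec (Table q) (suc m)) → tablesOf (cycleMap hs) ≡ hs
  tablesOf-cycleMap hs = Vec-ext λ v → Vec-ext λ a → trans (lookup-tablesOf (cycleMap hs) v a)
    (trans (lookup-cycleMap hs _ v) (cong (lookup (lookup hs v)) (Vec.lookup-replicate (prev v) a)))

  module _ {m q} (f : SelfMap (suc m) q) (G≗C : G f ≗ᴳ C⃗ (suc m)) where

    private
      value : ∀ x v → lookup (f x) v ≡ lookup (lookup (tablesOf f) v) (lookup x (prev v))
      value x v = trans
        (depends-only-on f (λ u arc → arc⇒prev u v (Equivalence.to (G≗C u v) arc)) x (replicate _ (lookup x (prev v)))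
          (sym (Vec.lookup-replicate (prev v) (lookup x (prev v)))))
        (sym (lookup-tablesOf f v (lookup x (prev v))))

    cycleMap-tablesOf : f ≗ cycleMap (tablesOf f)
    cycleMap-tablesOf x = Vec-ext λ v → trans (value x v) (sym (lookup-cycleMap (tablesOf f) x v))

    tablesOf-nonconstant : ∀ v → Nonconstant (lookup (tablesOf f) v)
    tablesOf-nonconstant v with Equivalence.from (G≗C (prev v) v) (prev-arc v)
    ... | x , y , _ , fx≢fy = lookup x (prev v) , lookup y (prev v)
      , λ eq → fx≢fy (trans (value x v) (trans eq (sym (value y v))))

  cycleTables : ∀ n q → List (Vec (Table q) n)
  cycleTables n q = vectors n (nonconstants q)

  cycleTables-nonconstant : ∀ {n q} {hs : Vec (Table q) n} → hs ∈ cycleTables n q → ∀ v → Nonconstant (lookup hs v)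
  cycleTables-nonconstant {n} {q} hs∈ v = proj₂ (∈-filter⁻ nonconstant? {xs = tables q} (Allᵛ.lookup⁺ (∈-vectors⁻ n hs∈) v))

  ∈-cycleTables : ∀ {n q} {hs : Vec (Table q) n} → (∀ v → Nonconstant (lookup hs v)) → hs ∈ cycleTables n q
  ∈-cycleTables {hs = hs} nc = ∈-vectors⁺ (Allᵛ.lookup⁻ (λ v → ∈-filter⁺ nonconstant? (∈-points (lookup hs v)) (nc v)))

  cycleTables-unique : ∀ n q → Unique (cycleTables n q)
  cycleTables-unique n q = vectors-unique n (Unique.filter⁺ nonconstant? (points-unique q q))

  -- The bijection is set up between tuples of tables and codes in `Fin M`, where equality is
  -- propositional; self-maps agree only pointwise, so `φ` has to respect `_≗_`.
  ∑-F : ∀ m q (φ : SelfMap (suc m) q → ℕ) → (∀ {f g} → f ≗ g → φ f ≡ φ g) →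
    ∑ F[ C⃗ (suc m) , q ] φ ≡ ∑ (cycleTables (suc m) q) (φ ∘ cycleMap)
  ∑-F m q φ φ-cong = begin
      ∑ F[ C⃗ (suc m) , q ] φ
        ≡⟨ trans (∑-filter G≗C? (selfMaps (suc m) q) φ) (∑-map decodeMap codes (λ f → χ (G≗C? f) ℕ.* φ f)) ⟩
      ∑ codes (λ c → χ (G≗C? (decodeMap c)) ℕ.* φ (decodeMap c))
        ≡⟨ sym (∑-filter (G≗C? ∘ decodeMap) codes (φ ∘ decodeMap)) ⟩
      ∑ (filter (G≗C? ∘ decodeMap) codes) (φ ∘ decodeMap)
        ≡⟨ ∑-sameElements (Unique.filter⁺ (G≗C? ∘ decodeMap) (Unique.allFin⁺ M))
             (Unique.map⁺ code-injective (cycleTables-unique (suc m) q)) (mk⇔ to from) (φ ∘ decodeMap) ⟩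
      ∑ (List.map code (cycleTables (suc m) q)) (φ ∘ decodeMap)
        ≡⟨ ∑-map code (cycleTables (suc m) q) (φ ∘ decodeMap) ⟩
      ∑ (cycleTables (suc m) q) (φ ∘ decodeMap ∘ code)
        ≡⟨ ∑-cong (cycleTables (suc m) q) (λ hs → φ-cong (decode-code hs)) ⟩
      ∑ (cycleTables (suc m) q) (φ ∘ cycleMap) ∎
    where
    open ≡-Reasoning
    M = (q ℕ.^ suc m) ℕ.^ (q ℕ.^ suc m)
    codes = allFin M
    G≗C? : (f : SelfMap (suc m) q) → Dec (G f ≗ᴳ C⃗ (suc m))
    G≗C? f = G f ≗ᴳ? C⃗ (suc m)
    code : Vec (Table q) (suc m) → Fin M
    code hs = proj₁ (decodeMap-surjective (cycleMap hs))
    decode-code : ∀ hs → decodeMap (code hs) ≗ cycleMap hs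
    decode-code hs = proj₂ (decodeMap-surjective (cycleMap hs))
    code-injective : ∀ {hs ks} → code hs ≡ code ks → hs ≡ ks
    code-injective {hs} {ks} eq = begin
      hs                      ≡⟨ sym (tablesOf-cycleMap hs) ⟩
      tablesOf (cycleMap hs)  ≡⟨ tablesOf-cong (λ x → trans (sym (decode-code hs x))
                                   (trans (cong (λ c → decodeMap c x) eq) (decode-code ks x))) ⟩
      tablesOf (cycleMap ks)  ≡⟨ tablesOf-cycleMap ks ⟩
      ks                      ∎
    to : ∀ {c} → c ∈ filter (G≗C? ∘ decodeMap) codes → c ∈ List.map code (cycleTables (suc m) q)
    to {c} c∈ = subst (_∈ List.map code (cycleTables (suc m) q))
      (decodeMap-injective (suc m) q (code hs) c
        (λ x → trans (decode-code hs x) (sym (cycleMap-tablesOf (decodeMap {suc m} {q} c) G≗C x))))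
      (∈-map⁺ code (∈-cycleTables {hs = hs} (tablesOf-nonconstant (decodeMap {suc m} {q} c) G≗C)))
      where
      G≗C = proj₂ (∈-filter⁻ (G≗C? ∘ decodeMap) {xs = codes} c∈)
      hs = tablesOf (decodeMap {suc m} {q} c)
    from : ∀ {c} → c ∈ List.map code (cycleTables (suc m) q) → c ∈ filter (G≗C? ∘ decodeMap) codes
    from {c} c∈ = let hs , hs∈ , eq = ∈-map⁻ code c∈ in
      subst (_∈ filter (G≗C? ∘ decodeMap) codes) (sym eq) (∈-filter⁺ (G≗C? ∘ decodeMap) (∈-allFin (code hs))
        (G-cycleMap {f = decodeMap (code hs)} hs (cycleTables-nonconstant hs∈) (decode-code hs)))

  -- Walks around the cycle, fixed points and distance to being fixed.

  trajectory : ∀ {n q} → Vec (Table q) n → Fin q → Vec (Fin q) n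
  trajectory []       a = []
  trajectory (h ∷ hs) a = lookup h a ∷ trajectory hs (lookup h a)

  -- The starting value is not recorded, so the last entry has passed through all the tables.
  last-trajectory : ∀ {m q} (hs : Vec (Table q) (suc m)) a → lookup (trajectory hs a) (fromℕ m) ≡ comp hs a
  last-trajectory (h ∷ [])      a = refl
  last-trajectory (h ∷ k ∷ hs)  a = last-trajectory (k ∷ hs) (lookup h a)

  shift-trajectory : ∀ {n q} (hs : Vec (Table q) n) a → zipWith lookup hs (shift a (trajectory hs a)) ≡ trajectory hs a
  shift-trajectory []       a = refl
  shift-trajectory (h ∷ hs) a = cong (lookup h a ∷_) (shift-trajectory hs (lookup h a))

  -- The equation determines the entries one after another from the entering value.
  trajectory-unique : ∀ {n q} (hs : Vec (Table q) n) {a} x → zipWith lookup hs (shift a x) ≡ x → trajectory hs a ≡ x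
  trajectory-unique []       []      _  = refl
  trajectory-unique (h ∷ hs) (b ∷ x) eq with Vec.∷-injectiveˡ eq
  ... | refl = cong (b ∷_) (trajectory-unique hs x (Vec.∷-injectiveʳ eq))

  configs-unique : ∀ n q → Unique (configs n q)
  configs-unique n q = Unique.map⁺
    (λ {c} {d} eq → trans (sym (encode-decode n q c)) (trans (cong encode eq) (encode-decode n q d))) (Unique.allFin⁺ (q ℕ.^ n))

  ∈-configs : ∀ {n q} (x : Config n q) → x ∈ configs n q
  ∈-configs x = subst (_∈ configs _ _) (decode-encode x) (∈-map⁺ decode (∈-allFin (encode x)))

  length-Fix-cong : ∀ {n q} {f g : SelfMap n q} → f ≗ g → length (Fix f) ≡ length (Fix g)
  length-Fix-cong {n} {q} {f} {g} f≗g = trans (length-filter≡∑ (λ x → f x ≟ᵛ x) (configs n q)) (trans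
    (∑-cong (configs n q) (λ x → cong (λ y → χ (y ≟ᵛ x)) (f≗g x)))
    (sym (length-filter≡∑ (λ x → g x ≟ᵛ x) (configs n q))))

  -- A fixed point is determined by its last coordinate, a fixed point of the composition around the cycle.
  length-Fix-cycleMap : ∀ {m q} (hs : Vec (Table q) (suc m)) → length (Fix (cycleMap hs)) ≡ fixedPoints hs
  length-Fix-cycleMap {m} {q} hs = begin
      length (Fix (cycleMap hs))
        ≡⟨ length-filter≡∑ (λ x → cycleMap hs x ≟ᵛ x) (configs (suc m) q) ⟩
      ∑ (configs (suc m) q) (λ x → χ (cycleMap hs x ≟ᵛ x))
        ≡⟨ ∑-cong (configs (suc m) q) (λ x →
             sym (∑-δ Fin._≟_ (Unique.allFin⁺ q) (∈-allFin (end x)) (λ _ → χ (cycleMap hs x ≟ᵛ x)))) ⟩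
      ∑ (configs (suc m) q) (λ x → ∑ (allFin q) (λ a → χ (end x Fin.≟ a) ℕ.* χ (cycleMap hs x ≟ᵛ x)))
        ≡⟨ ∑-comm (configs (suc m) q) (allFin q) _ ⟩
      ∑ (allFin q) (λ a → ∑ (configs (suc m) q) (λ x → χ (end x Fin.≟ a) ℕ.* χ (cycleMap hs x ≟ᵛ x)))
        ≡⟨ ∑-cong (allFin q) (λ a → ∑-cong (configs (suc m) q) (λ x → same a x)) ⟩
      ∑ (allFin q) (λ a → ∑ (configs (suc m) q) (λ x → χ (trajectory hs a ≟ᵛ x) ℕ.* χ (comp hs a Fin.≟ a)))
        ≡⟨ ∑-cong (allFin q) (λ a →
             ∑-δ _≟ᵛ_ (configs-unique (suc m) q) (∈-configs (trajectory hs a)) (λ _ → χ (comp hs a Fin.≟ a))) ⟩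
      fixedPoints hs ∎
    where
    open ≡-Reasoning
    end : Config (suc m) q → Fin q
    end x = lookup x (fromℕ m)
    -- If `x` ends in `a`, being fixed forces `x` to be the trajectory from `a`; ending in `a` then
    -- says that the walk closes up.
    same : ∀ a x → χ (end x Fin.≟ a) ℕ.* χ (cycleMap hs x ≟ᵛ x) ≡ χ (trajectory hs a ≟ᵛ x) ℕ.* χ (comp hs a Fin.≟ a)
    same a x = trans (sym (χ-× (end x Fin.≟ a) (cycleMap hs x ≟ᵛ x))) (trans
      (χ-cong ((end x Fin.≟ a) ×-dec (cycleMap hs x ≟ᵛ x)) ((trajectory hs a ≟ᵛ x) ×-dec (comp hs a Fin.≟ a))
        (λ { (refl , fixed) → let orbit = trajectory-unique hs x fixed in
               orbit , trans (sym (last-trajectory hs a)) (cong end orbit) })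
        (λ { (refl , closed) → let ends = trans (last-trajectory hs a) closed in
               ends , trans (cong (λ b → zipWith lookup hs (shift b (trajectory hs a))) ends) (shift-trajectory hs a) }))
      (χ-× (trajectory hs a ≟ᵛ x) (comp hs a Fin.≟ a)))

  d-H≡∑ : ∀ {n q} (x y : Config n q) → d-H x y ≡ ∑ (allFin n) (λ v → χ (¬? (lookup x v Fin.≟ lookup y v)))
  d-H≡∑ {n} x y = length-filter≡∑ (λ v → ¬? (lookup x v Fin.≟ lookup y v)) (allFin n)

  d-H-refl : ∀ {n q} (x : Config n q) → d-H x x ≡ 0
  d-H-refl {n} x = trans (d-H≡∑ x x) (trans
    (∑-cong (allFin n) (λ v → χ-false (¬? (lookup x v Fin.≟ lookup x v)) (λ neq → neq refl))) (∑-0 (allFin n)))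

  d-H-pos : ∀ {n q} (x y : Config n q) → x ≢ y → 1 ℕ.≤ d-H x y
  d-H-pos {n} x y x≢y with d-H x y in eq
  ... | suc _ = s≤s z≤n
  ... | zero  = contradiction (Vec-ext agree) x≢y
    where
    agree : ∀ v → lookup x v ≡ lookup y v
    agree v = decidable-stable (lookup x v Fin.≟ lookup y v) λ neq → contradiction
      (∈-filter⁺ (λ v → ¬? (lookup x v Fin.≟ lookup y v)) (∈-allFin v) neq) (empty eq)
      where
      empty : ∀ {A : Set} {xs : List A} {z} → length xs ≡ 0 → ¬ (z ∈ xs)
      empty {xs = []} _ ()

  i-cong : ∀ {n q} {f g : SelfMap n q} → f ≗ g → i f ≡ i g
  i-cong {n} {q} f≗g = cong (min n) (List.map-cong (λ x → cong (d-H x) (f≗g x)) (configs n q))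

  -- A trajectory around the cycle can only fail to be fixed at the first coordinate.
  d-H-trajectory : ∀ {m q} (hs : Vec (Table q) (suc m)) a → d-H (trajectory hs a) (cycleMap hs (trajectory hs a)) ℕ.≤ 1
  d-H-trajectory {m} hs a = begin
      d-H x (cycleMap hs x)
        ≡⟨ d-H≡∑ x (cycleMap hs x) ⟩
      ∑ (allFin (suc m)) (λ v → χ (¬? (lookup x v Fin.≟ lookup (cycleMap hs x) v)))
        ≤⟨ ∑-mono (allFin (suc m)) (λ v → first v) ⟩
      ∑ (allFin (suc m)) (λ v → χ (Fin.zero Fin.≟ v) ℕ.* 1)
        ≡⟨ ∑-δ Fin._≟_ (Unique.allFin⁺ (suc m)) (∈-allFin Fin.zero) (λ _ → 1) ⟩
      1 ∎
    where
    open ℕ.≤-Reasoning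
    x = trajectory hs a
    first : ∀ v → χ (¬? (lookup x v Fin.≟ lookup (cycleMap hs x) v)) ℕ.≤ χ (Fin.zero Fin.≟ v) ℕ.* 1
    first Fin.zero    = χ-≤1 (¬? (lookup x Fin.zero Fin.≟ lookup (cycleMap hs x) Fin.zero))
    first (Fin.suc k) = ℕ.≤-reflexive
      (χ-false (¬? (lookup x (Fin.suc k) Fin.≟ lookup (cycleMap hs x) (Fin.suc k))) (λ neq → neq (sym (step k))))
      where
      step : ∀ k → lookup (cycleMap hs x) (Fin.suc k) ≡ lookup x (Fin.suc k)
      step k = trans (lookup-cycleMap hs x (Fin.suc k))
        (trans (cong (lookup (lookup hs (Fin.suc k))) (sym (lookup-shift a x k)))
        (trans (sym (Vec.lookup-zipWith lookup (Fin.suc k) hs (shift a x)))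
        (cong (λ y → lookup y (Fin.suc k)) (shift-trajectory hs a))))

  -- A fixed point gives distance 0. Without one, every distance is at least 1, and the trajectory
  -- from the supplied element of `Fin q` attains it.
  i-cycleMap : ∀ {m q} → Fin q → (hs : Vec (Table q) (suc m)) → i (cycleMap hs) ≡ χ (length (Fix (cycleMap hs)) ℕ.≟ 0)
  i-cycleMap {m} {q} a hs with Fix (cycleMap hs) in eq
  ... | x ∷ _ = ℕ.n≤0⇒n≡0 (min≤v⁺ (suc m) _ (inj₂ (Any.map⁺ (Any.map
      (λ { refl → ℕ.≤-reflexive (trans (cong (d-H x) fixed) (d-H-refl x)) }) (∈-configs x)))))
    where
    fixed : cycleMap hs x ≡ x
    fixed = proj₂ (∈-filter⁻ (λ x → cycleMap hs x ≟ᵛ x) {xs = configs (suc m) q} (subst (x ∈_) (sym eq) (here refl)))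
  ... | []    = ℕ.≤-antisym
    (min≤v⁺ (suc m) _ (inj₂ (Any.map⁺ (Any.map (λ { refl → d-H-trajectory hs a }) (∈-configs (trajectory hs a))))))
    -- The default `suc m` of `min` has to be at least 1 as well.
    (v≤min⁺ {v = 1} (s≤s z≤n) (All.map⁺ (All.universal (λ x → d-H-pos x (cycleMap hs x) (λ x≡ →
      contradiction (subst (x ∈_) eq (∈-filter⁺ (λ x → cycleMap hs x ≟ᵛ x) (∈-configs x) (sym x≡))) λ ())) (configs (suc m) q))))

open CycleMaps

-- Limits in the reals and the lower bound.

open import Defs
open import Data.Integer using (+_)
open import Data.Nat as ℕ using (ℕ; suc; pred; z≤n; s≤s)
import Data.Nat.Properties as ℕ
open import Data.Nat.Tactic.RingSolver using (solve-∀)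
open import Data.Rational as ℚ using (ℚ; 0ℚ; 1ℚ; ½)
import Data.Rational.Properties as ℚ
open import Data.Rational.Solver using (module +-*-Solver)
open import Relation.Nullary.Decidable using (toWitness)
open +-*-Solver using (solve; _:+_; _:*_; _:-_; :-_; con; _:=_)

-- Only the representing sequence of x occurs, so no two reals are compared.
Approaches : (ℕ → ℚ) → ℝ → Set
Approaches s x = ∀ δ → 0ℚ ℚ.< δ →
  ∃[ N ] ∀ q → N ℕ.≤ q → ∃[ M ] ∀ k → M ℕ.≤ k → ℚ.∣ s q ℚ.- seq x k ∣ ℚ.< δ

halve-pos : ∀ {δ} → 0ℚ ℚ.< δ → 0ℚ ℚ.< ½ ℚ.* δ
halve-pos {δ} 0<δ = subst (ℚ._< ½ ℚ.* δ) (ℚ.*-zeroʳ ½) (ℚ.*-monoʳ-<-pos ½ 0<δ)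

halves : ∀ δ → ½ ℚ.* δ ℚ.+ ½ ℚ.* δ ≡ δ
halves = solve 1 (λ δ → con ½ :* δ :+ con ½ :* δ := δ) refl

-- A positive real `ε` is eventually above a rational gap `δ`; one half of `δ` bounds the distance,
-- the other is the gap that a strict inequality of reals requires.
approaches⇒⟶ : ∀ s x → Approaches s x → (λ q → fromℚ (s q)) ⟶ x
approaches⇒⟶ s x approaches ε (δ , 0<δ , L , δ≤ε) = proj₁ near , λ q N≤q →
  let M , close = proj₂ near q N≤q in
  ½ ℚ.* δ , halve-pos 0<δ , M ℕ.⊔ L , λ k h → begin
    ℚ.∣ s q ℚ.- seq x k ∣ ℚ.+ ½ ℚ.* δ  ≤⟨ ℚ.+-monoˡ-≤ (½ ℚ.* δ) (ℚ.<⇒≤ (close k (ℕ.m⊔n≤o⇒m≤o M L h))) ⟩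
    ½ ℚ.* δ ℚ.+ ½ ℚ.* δ                ≡⟨ trans (halves δ) (sym (ℚ.+-identityˡ δ)) ⟩
    0ℚ ℚ.+ δ                           ≤⟨ δ≤ε k (ℕ.m⊔n≤o⇒n≤o M L h) ⟩
    seq ε k                            ∎
  where
  open ℚ.≤-Reasoning
  near = approaches (½ ℚ.* δ) (halve-pos 0<δ)

approaches-cong : ∀ {s t} x L → (∀ q → L ℕ.≤ q → s q ≡ t q) → Approaches s x → Approaches t x
approaches-cong x L eq approaches δ 0<δ = let N , close = approaches δ 0<δ in
  L ℕ.⊔ N , λ q h → let M , close′ = close q (ℕ.m⊔n≤o⇒n≤o L N h) in
  M , λ k M≤k → subst (λ y → ℚ.∣ y ℚ.- seq x k ∣ ℚ.< δ) (eq q (ℕ.m⊔n≤o⇒m≤o L N h)) (close′ k M≤k)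

approaches-complement : ∀ s t x → Approaches s x → Approaches t x →
  Approaches (λ q → 1ℚ ℚ.- (s q ℚ.+ t q)) (1ℝ - 2 · x)
approaches-complement s t x s→x t→x δ 0<δ =
  let N₁ , close₁ = s→x (½ ℚ.* δ) (halve-pos 0<δ)
      N₂ , close₂ = t→x (½ ℚ.* δ) (halve-pos 0<δ) in
  N₁ ℕ.⊔ N₂ , λ q h →
  let M₁ , close₁′ = close₁ q (ℕ.m⊔n≤o⇒m≤o N₁ N₂ h)
      M₂ , close₂′ = close₂ q (ℕ.m⊔n≤o⇒n≤o N₁ N₂ h) in
  M₁ ℕ.⊔ M₂ , λ k h′ → begin-strict
    -- The inner `0ℚ` comes from unfolding `2 · x`.
    ℚ.∣ 1ℚ ℚ.- (s q ℚ.+ t q) ℚ.- (1ℚ ℚ.- (seq x k ℚ.+ (seq x k ℚ.+ 0ℚ))) ∣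
      ≡⟨ cong ℚ.∣_∣ (rearrange (s q) (t q) (seq x k)) ⟩
    ℚ.∣ ℚ.- ((s q ℚ.- seq x k) ℚ.+ (t q ℚ.- seq x k)) ∣
      ≡⟨ ℚ.∣-p∣≡∣p∣ ((s q ℚ.- seq x k) ℚ.+ (t q ℚ.- seq x k)) ⟩
    ℚ.∣ (s q ℚ.- seq x k) ℚ.+ (t q ℚ.- seq x k) ∣
      ≤⟨ ℚ.∣p+q∣≤∣p∣+∣q∣ (s q ℚ.- seq x k) (t q ℚ.- seq x k) ⟩
    ℚ.∣ s q ℚ.- seq x k ∣ ℚ.+ ℚ.∣ t q ℚ.- seq x k ∣
      <⟨ ℚ.+-mono-< (close₁′ k (ℕ.m⊔n≤o⇒m≤o M₁ M₂ h′)) (close₂′ k (ℕ.m⊔n≤o⇒n≤o M₁ M₂ h′)) ⟩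
    ½ ℚ.* δ ℚ.+ ½ ℚ.* δ
      ≡⟨ halves δ ⟩
    δ ∎
  where
  open ℚ.≤-Reasoning
  rearrange : ∀ a b e → 1ℚ ℚ.- (a ℚ.+ b) ℚ.- (1ℚ ℚ.- (e ℚ.+ (e ℚ.+ 0ℚ))) ≡ ℚ.- ((a ℚ.- e) ℚ.+ (b ℚ.- e))
  rearrange = solve 3 (λ a b e → con 1ℚ :- (a :+ b) :- (con 1ℚ :- (e :+ (e :+ con 0ℚ))) := :- ((a :- e) :+ (b :- e))) refl

-- The cut of the alternating series and the index into the sequence of e⁻¹ are one number `suc K`;
-- the cut is exact once `q ≤ K`, hence the threshold `suc q`.
approaches-e⁻¹ : ∀ s C →
  (∀ q K → 3 ℕ.≤ q → q ℕ.≤ K → ι q ℚ.* ℚ.∣ s q ℚ.- expSum (ℚ.- 1ℚ) (suc K) ∣ ℚ.≤ ι C) →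
  Approaches s e⁻¹
approaches-e⁻¹ s C bound δ 0<δ = let N , small = archimedean C 0<δ in
  3 ℕ.⊔ N , λ q h → suc q , λ { (suc K) (s≤s q≤K) →
    small q (ℕ.m⊔n≤o⇒n≤o 3 N h) (bound q K (ℕ.m⊔n≤o⇒m≤o 3 N h) q≤K) }

-- From `expSum≤`, the approximations to 1 - 2e⁻¹ are eventually at least 1 - 10/12 = 1/6. This
-- number is both the allowed deviation from them and what remains.
1/12 : ℚ
1/12 = + 1 ℚ./ 12

module _ (m : ℕ) where

  private
    n = suc m

    T : ℕ → ℕ
    T q = length (nonconstants q) ℕ.^ n

    Z : {P : ℕ → Set} → Decidable P → ℕ → ℕ
    Z P? q = ∑ (cycleTables n q) (λ hs → χ (P? (fixedPoints hs)))

    length-F : ∀ q → length F[ C⃗ n , q ] ≡ T q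
    length-F q = trans (sym (∑-1 F[ C⃗ n , q ])) (trans (∑-F m q (λ _ → 1) (λ _ → refl)) (∑-vectors-1 (nonconstants q) n))

    length-filter-F : {P : ℕ → Set} (P? : Decidable P) → ∀ q →
      length (filter (λ f → P? (length (Fix f))) F[ C⃗ n , q ]) ≡ Z P? q
    length-filter-F P? q = trans (length-filter≡∑ (λ f → P? (length (Fix f))) F[ C⃗ n , q ]) (trans
      (∑-F m q (λ f → χ (P? (length (Fix f)))) (λ f≗g → cong (λ k → χ (P? k)) (length-Fix-cong f≗g)))
      (∑-cong (cycleTables n q) (λ hs → cong (λ k → χ (P? k)) (length-Fix-cycleMap hs))))

    proportion-F : {P : ℕ → Set} (P? : Decidable P) → ∀ q →
      proportion (λ f → P? (length (Fix f))) F[ C⃗ n , q ] ≡ ratio (Z P? q) (T q)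
    proportion-F P? q = cong₂ ratio (length-filter-F P? q) (length-F q)

    T≢0 : ∀ {q} → 3 ℕ.≤ q → ℕ.NonZero (T q)
    T≢0 {q} 3≤q = ℕ.m^n≢0 (length (nonconstants q)) n {{nonconstants-nonempty 3≤q}}

    -- The power stems from `^-close`, the 2 from `moment-base`.
    C = 3 ℕ.^ n ℕ.* 2

    -- Here `j k` is the order of the moment paired with `term k`: `k` for no fixed point, `suc k`
    -- for exactly one.
    proportion-close : {P : ℕ → Set} (P? : Decidable P) (j : ℕ → ℕ) → (∀ k → j k ℕ.* pred (j k) ℕ.≤ k ℕ.* suc k) →
      (∀ X {K} → X ℕ.< K → ι (χ (P? X)) ≡ sumTo K (λ k → term k ℚ.* ι (fall X (j k)))) →
      ∀ q K → 3 ℕ.≤ q → q ℕ.≤ K →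
      ι q ℚ.* ℚ.∣ proportion (λ f → P? (length (Fix f))) F[ C⃗ n , q ] ℚ.- expSum (ℚ.- 1ℚ) (suc K) ∣ ℚ.≤ ι (C ℕ.* 9)
    proportion-close P? j j≤ series q K 3≤q q≤K = subst
      (λ p → ι q ℚ.* ℚ.∣ p ℚ.- expSum (ℚ.- 1ℚ) (suc K) ∣ ℚ.≤ ι (C ℕ.* 9))
      (sym (proportion-F P? q))
      (ratio-close q (T q) C (moment 3≤q n ∘ j) close {{T≢0 3≤q}} (Z P? q) K
        (∑-sumTo (cycleTables n q) (suc K) (λ hs → series (fixedPoints hs) (s≤s (ℕ.≤-trans (fixedPoints≤q hs) q≤K)))))
      where
      open ℕ.≤-Reasoning
      rearrange : ∀ t w N → t ℕ.* (2 ℕ.* w) ℕ.* N ≡ t ℕ.* 2 ℕ.* w ℕ.* N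
      rearrange = solve-∀
      close : ∀ k → q ℕ.* ℕ.∣ moment 3≤q n (j k) - T q ∣ ℕ.≤ C ℕ.* (k ℕ.* suc k) ℕ.* T q
      close k = begin
        q ℕ.* ℕ.∣ moment 3≤q n (j k) - T q ∣                    ≤⟨ moment-close 3≤q m (j k) ⟩
        3 ℕ.^ n ℕ.* (2 ℕ.* (j k ℕ.* pred (j k))) ℕ.* T q        ≡⟨ rearrange (3 ℕ.^ n) (j k ℕ.* pred (j k)) (T q) ⟩
        C ℕ.* (j k ℕ.* pred (j k)) ℕ.* T q                      ≤⟨ ℕ.*-monoˡ-≤ (T q) (ℕ.*-monoʳ-≤ C (j≤ k)) ⟩
        C ℕ.* (k ℕ.* suc k) ℕ.* T q                             ∎

  p₀-approaches : Approaches (p₀ (C⃗ n)) e⁻¹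
  p₀-approaches = approaches-e⁻¹ (p₀ (C⃗ n)) (C ℕ.* 9) (proportion-close (ℕ._≟ 0) (λ k → k)
    (λ k → ℕ.*-monoʳ-≤ k (ℕ.≤-trans (ℕ.pred[n]≤n {k}) (ℕ.n≤1+n k))) alternating-0)

  p₁-approaches : Approaches (p₁ (C⃗ n)) e⁻¹
  p₁-approaches = approaches-e⁻¹ (p₁ (C⃗ n)) (C ℕ.* 9) (proportion-close (ℕ._≟ 1) suc
    (λ k → ℕ.≤-reflexive (ℕ.*-comm (suc k) k)) alternating-1)

  p₂-complement : ∀ q → 3 ℕ.≤ q → 1ℚ ℚ.- (p₀ (C⃗ n) q ℚ.+ p₁ (C⃗ n) q) ≡ p₂ (C⃗ n) q
  p₂-complement q 3≤q = trans
    (cong₂ (λ a b → 1ℚ ℚ.- (a ℚ.+ b)) (proportion-F (ℕ._≟ 0) q) (proportion-F (ℕ._≟ 1) q))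
    (trans (sym (ratio-complement (T q) {{T≢0 3≤q}} partition)) (sym (proportion-F (2 ℕ.≤?_) q)))
    where
    open ≡-Reasoning
    cases : ∀ X → χ (X ℕ.≟ 0) ℕ.+ χ (X ℕ.≟ 1) ℕ.+ χ (2 ℕ.≤? X) ≡ 1
    cases 0             = refl
    cases 1             = refl
    cases (suc (suc X)) = χ-true (2 ℕ.≤? suc (suc X)) (s≤s (s≤s z≤n))
    hss = cycleTables n q
    partition : Z (ℕ._≟ 0) q ℕ.+ Z (ℕ._≟ 1) q ℕ.+ Z (2 ℕ.≤?_) q ≡ T q
    partition = begin
      Z (ℕ._≟ 0) q ℕ.+ Z (ℕ._≟ 1) q ℕ.+ Z (2 ℕ.≤?_) q
        ≡⟨ cong (ℕ._+ Z (2 ℕ.≤?_) q) (sym (∑-+ hss _ _)) ⟩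
      ∑ hss (λ hs → χ (fixedPoints hs ℕ.≟ 0) ℕ.+ χ (fixedPoints hs ℕ.≟ 1)) ℕ.+ Z (2 ℕ.≤?_) q
        ≡⟨ sym (∑-+ hss _ _) ⟩
      ∑ hss (λ hs → χ (fixedPoints hs ℕ.≟ 0) ℕ.+ χ (fixedPoints hs ℕ.≟ 1) ℕ.+ χ (2 ℕ.≤? fixedPoints hs))
        ≡⟨ ∑-cong hss (λ hs → cases (fixedPoints hs)) ⟩
      ∑ hss (λ _ → 1)
        ≡⟨ ∑-vectors-1 (nonconstants q) n ⟩
      T q ∎

  p₂-approaches : Approaches (p₂ (C⃗ n)) (1ℝ - 2 · e⁻¹)
  p₂-approaches = approaches-cong {λ q → 1ℚ ℚ.- (p₀ (C⃗ n) q ℚ.+ p₁ (C⃗ n) q)} (1ℝ - 2 · e⁻¹) 3 p₂-complement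
    (approaches-complement (p₀ (C⃗ n)) (p₁ (C⃗ n)) e⁻¹ p₀-approaches p₁-approaches)

  avg-i≡p₀ : ∀ q → 1 ℕ.≤ q → p₀ (C⃗ n) q ≡ avg-i (C⃗ n) q
  avg-i≡p₀ q 1≤q = cong (λ a → ratio a (length F[ C⃗ n , q ])) (begin
      length (filter (λ f → length (Fix f) ℕ.≟ 0) F[ C⃗ n , q ])
        ≡⟨ length-filter≡∑ (λ f → length (Fix f) ℕ.≟ 0) F[ C⃗ n , q ] ⟩
      ∑ F[ C⃗ n , q ] (λ f → χ (length (Fix f) ℕ.≟ 0))
        ≡⟨ ∑-F m q _ (λ f≗g → cong (λ k → χ (k ℕ.≟ 0)) (length-Fix-cong f≗g)) ⟩
      ∑ (cycleTables n q) (λ hs → χ (length (Fix (cycleMap hs)) ℕ.≟ 0))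
        ≡⟨ ∑-cong (cycleTables n q) (λ hs → sym (i-cycleMap (Fin.fromℕ< 1≤q) hs)) ⟩
      ∑ (cycleTables n q) (i ∘ cycleMap)
        ≡⟨ sym (∑-F m q i i-cong) ⟩
      ∑ F[ C⃗ n , q ] i ∎)
    where open ≡-Reasoning

  avg-i-approaches : Approaches (avg-i (C⃗ n)) e⁻¹
  avg-i-approaches = approaches-cong {p₀ (C⃗ n)} e⁻¹ 1 avg-i≡p₀ p₀-approaches

  p₂-bounded-below : ∃[ q₀ ] ∀ q → q₀ ℕ.≤ q → 1/12 ℚ.≤ p₂ (C⃗ n) q
  p₂-bounded-below = let N , close = p₂-approaches 1/12 (toWitness {a? = 0ℚ ℚ.<? 1/12} _) in
    N , λ q N≤q → let M , close′ = close q N≤q in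
    -- One index suffices, late enough for the closeness and at least 4 for `expSum≤`.
    bound (p₂ (C⃗ n) q) (expSum (ℚ.- 1ℚ) (M ℕ.⊔ 4)) (expSum≤ (ℕ.m≤n⊔m M 4)) (close′ (M ℕ.⊔ 4) (ℕ.m≤m⊔n M 4))
    where
    open ℚ.≤-Reasoning
    bound : ∀ p e → e ℚ.≤ + 5 ℚ./ 12 → ℚ.∣ p ℚ.- (1ℚ ℚ.- (e ℚ.+ (e ℚ.+ 0ℚ))) ∣ ℚ.< 1/12 → 1/12 ℚ.≤ p
    bound p e e≤ close = begin
      1/12
        ≡⟨⟩
      1ℚ ℚ.- (+ 5 ℚ./ 12 ℚ.+ (+ 5 ℚ./ 12 ℚ.+ 0ℚ)) ℚ.- 1/12
        ≤⟨ ℚ.+-mono-≤ (ℚ.+-monoʳ-≤ 1ℚ (ℚ.neg-antimono-≤ (ℚ.+-mono-≤ e≤ (ℚ.+-monoˡ-≤ 0ℚ e≤))))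
                      (ℚ.neg-antimono-≤ (ℚ.<⇒≤ close)) ⟩
      x ℚ.- ℚ.∣ p ℚ.- x ∣
        ≤⟨ ℚ.+-monoʳ-≤ x (ℚ.neg-antimono-≤ (ℚ.≤-trans (p≤∣p∣ (ℚ.- (p ℚ.- x)))
             (ℚ.≤-reflexive (ℚ.∣-p∣≡∣p∣ (p ℚ.- x))))) ⟩
      x ℚ.- (ℚ.- (p ℚ.- x))
        ≡⟨ solve 2 (λ p x → x :- (:- (p :- x)) := p) refl p x ⟩
      p ∎
      where x = 1ℚ ℚ.- (e ℚ.+ (e ℚ.+ 0ℚ))

theorem4p7 : (n : ℕ) → 2 ℕ.≤ n →
    (∃[ a ] 0ℝ < a × a < 1ℝ ×
    (∃[ q₀ ] ∀ q → q₀ ℕ.≤ q → a ≤ fromℚ (p₂ (C⃗ n) q)))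
    × ((λ q → fromℚ (p₀ (C⃗ n) q)) ⟶ e⁻¹)
    × ((λ q → fromℚ (p₁ (C⃗ n) q)) ⟶ e⁻¹)
    × ((λ q → fromℚ (p₂ (C⃗ n) q)) ⟶ 1ℝ - 2 · e⁻¹)
    × ((λ q → fromℚ (avg-i (C⃗ n) q)) ⟶ e⁻¹)
theorem4p7 (suc m) _ =
    (fromℚ 1/12
      , (1/12 , toWitness {a? = 0ℚ ℚ.<? 1/12} _ , 0 , λ _ _ → ℚ.≤-refl)
      , (½ , toWitness {a? = 0ℚ ℚ.<? ½} _ , 0 , λ _ _ → toWitness {a? = 1/12 ℚ.+ ½ ℚ.≤? 1ℚ} _)
      , let q₀ , bound = p₂-bounded-below m in
        -- `_≤_` is a negation: a gap `δ` placing `p₂` below 1/12 is refuted at the index `N`, the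
        -- sequences being constant.
        q₀ , λ { q q₀≤q (δ , 0<δ , N , p₂+δ≤a) →
          ℚ.<-irrefl refl (ℚ.<-≤-trans (exceeds q δ 0<δ (bound q q₀≤q)) (p₂+δ≤a N ℕ.≤-refl)) })
  , approaches⇒⟶ (p₀ (C⃗ (suc m))) e⁻¹ (p₀-approaches m)
  , approaches⇒⟶ (p₁ (C⃗ (suc m))) e⁻¹ (p₁-approaches m)
  , approaches⇒⟶ (p₂ (C⃗ (suc m))) (1ℝ - 2 · e⁻¹) (p₂-approaches m)
  , approaches⇒⟶ (avg-i (C⃗ (suc m))) e⁻¹ (avg-i-approaches m)
  where
  exceeds : ∀ q δ → 0ℚ ℚ.< δ → 1/12 ℚ.≤ p₂ (C⃗ (suc m)) q → 1/12 ℚ.< p₂ (C⃗ (suc m)) q ℚ.+ δ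
  exceeds q δ 0<δ a≤p = subst (ℚ._< p₂ (C⃗ (suc m)) q ℚ.+ δ) (ℚ.+-identityʳ 1/12) (ℚ.+-mono-≤-< a≤p 0<δ)
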